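{- Let $\varepsilon > 0$. Then for every prime $q$ sufficiently large with respect to $1/\varepsilon$, and every integer $a$ with $(a,q)=1$, there exist positive integers $n, m \leq q^{5/2+\varepsilon}$ with $n \equiv m \equiv a \pmod{q}$ such that $\lambda(n) = -1$ and $\lambda(m) = 1$.
   Context: $\lambda$ denotes the Liouville function: $\lambda(n) = (-1)^{\Omega(n)}$, where $\Omega(n)$ is the number of prime factors of $n$ counted with multiplicity. -}

module Defs where

open import Data.Nat using (ℕ; _*_)
open import Data.Nat.Primality using (Prime)
open import Data.List using (List; length)
open import Data.Nat.ListAction using (product)
open import Data.List.Relation.Unary.All using (All)
open import Data.Product using (Σ; _×_)
open import Relation.Binary.PropositionalEquality using (_≡_)
open import Data.Integer using (ℤ; +_; -[1+_]; -_)
open import Data.Integer using () renaming (_^_ to _^ℤ_)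

PrimeFactorization : ℕ → List ℕ → Set
PrimeFactorization n ps = All Prime ps × product ps ≡ n

-- Ω n k : "Ω(n) = k", i.e. n has k prime factors counted with multiplicity
-- (the length of a prime factorization of n; well-defined by unique factorization).
Ω≡ : ℕ → ℕ → Set
Ω≡ n k = Σ (List ℕ) (λ ps → PrimeFactorization n ps × length ps ≡ k)

Liouville≡ : ℕ → ℤ → Set
Liouville≡ n v = Σ ℕ (λ k → Ω≡ n k × ((- (+ 1)) ^ℤ k) ≡ v)

{-# OPTIONS --safe #-}
-- The bound q^(5/2) needs no ε and the threshold is absolute. Let K = ⌊√q⌋ and suppose that λ is
-- constant on the n ≡ a (mod q) with n ≤ q²K. Multiplying n ≤ qK by a v < q with vn ≡ a shows that
-- λ(n) depends only on n mod q for n ≤ qK prime to q; let χ be the induced function on residues.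
-- By Thue's lemma every residue is ±r/s with r, s ≤ K, and products of an integer below q with one
-- of size at most K stay below qK, so χ is completely multiplicative: a quadratic character with
-- χ(p) = -1 for every prime p ≤ qK other than q. Quadratic reciprocity refutes this: with
-- η = χ(-1), take a prime p dividing ηq - 4, so that ηq is a square modulo the odd prime p and
-- χ(p) = 1. Reciprocity is obtained from Gauss sums: convolution with χ satisfies G³ = ηqG,
-- while the p-th power of G is given modulo p by the Frobenius.
module Submission where

-- Semirings of additive operators and the Frobenius.

module OperatorSemirings where
  open import Level using (Level; _⊔_)
  open import Algebra.Bundles using (CommutativeMonoid; Semiring)
  open import Algebra.Structures using (IsSemiring)
  open import Algebra.Morphism.Structures using (module MonoidMorphisms)
  open import Data.Fin using (Fin; zero; suc; fromℕ; inject₁)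
  open import Data.Fin.Properties using (toℕ<n; toℕ-fromℕ; toℕ-inject₁)
  open import Data.Nat as ℕ using (ℕ; zero; suc; z≤n; s≤s; _!)
  open import Data.Nat.Combinatorics using (_C_; nCn≡1; k![n∸k]!∣n!)
  open import Data.Nat.Combinatorics.Specification using (nCk≡n!/k![n-k]!)
  import Data.Nat.Divisibility as ℕ∣
  open import Data.Nat.DivMod using (m/n*n≡m)
  open import Data.Nat.Primality using (Prime; euclidsLemma; prime⇒nonTrivial)
  import Data.Nat.Properties as ℕₚ
  open import Data.Product using (_,_)
  open import Data.Sum using (inj₁; inj₂)
  open import Relation.Nullary using (¬_; contradiction)
  open import Relation.Binary.PropositionalEquality using (_≡_; refl; sym; trans; cong; subst)

  module _ {c ℓ : Level} (M : CommutativeMonoid c ℓ) where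
    open CommutativeMonoid M hiding (refl; sym; trans)
    open MonoidMorphisms rawMonoid rawMonoid using (IsMonoidHomomorphism)
    open import Algebra.Properties.CommutativeSemigroup commutativeSemigroup using (interchange)

    -- Operators replace the group ring of `ℤ/q`: with composition as product, associativity and the
    -- unit laws hold by definition, and a Gauss sum is simply the operator of convolution with it.
    record Endomorphism : Set (c ⊔ ℓ) where
      no-eta-equality
      constructor endomorphism
      field
        apply : Carrier → Carrier
        isHomomorphism : IsMonoidHomomorphism apply
      open IsMonoidHomomorphism isHomomorphism public using (⟦⟧-cong; homo; ε-homo)

    open Endomorphism

    mkIsHomomorphism : ∀ {f : Carrier → Carrier} → (∀ {x y} → x ≈ y → f x ≈ f y) →
                       (∀ x y → f (x ∙ y) ≈ f x ∙ f y) → f ε ≈ ε → IsMonoidHomomorphism f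
    mkIsHomomorphism f-cong f-homo f-ε = record
      { isMagmaHomomorphism = record
        { isRelHomomorphism = record { cong = f-cong }
        ; homo = f-homo
        }
      ; ε-homo = f-ε
      }

    -- Abstract, so that comparing two operators never compares unfolded proofs.
    abstract
      ∙-isHomomorphism : ∀ f g → IsMonoidHomomorphism (λ x → apply f x ∙ apply g x)
      ∙-isHomomorphism f g = mkIsHomomorphism
        (λ x≈y → ∙-cong (⟦⟧-cong f x≈y) (⟦⟧-cong g x≈y))
        (λ x y → CommutativeMonoid.trans M (∙-cong (homo f x y) (homo g x y)) (interchange _ _ _ _))
        (CommutativeMonoid.trans M (∙-cong (ε-homo f) (ε-homo g)) (identityˡ ε))

      ∘-isHomomorphism : ∀ f g → IsMonoidHomomorphism (λ x → apply f (apply g x))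
      ∘-isHomomorphism f g = mkIsHomomorphism
        (λ x≈y → ⟦⟧-cong f (⟦⟧-cong g x≈y))
        (λ x y → CommutativeMonoid.trans M (⟦⟧-cong f (homo g x y)) (homo f _ _))
        (CommutativeMonoid.trans M (⟦⟧-cong f (ε-homo g)) (ε-homo f))

      ε-isHomomorphism : IsMonoidHomomorphism (λ _ → ε)
      ε-isHomomorphism = mkIsHomomorphism (λ _ → CommutativeMonoid.refl M)
        (λ _ _ → CommutativeMonoid.sym M (identityˡ ε)) (CommutativeMonoid.refl M)

      id-isHomomorphism : IsMonoidHomomorphism (λ x → x)
      id-isHomomorphism = mkIsHomomorphism (λ x≈y → x≈y)
        (λ _ _ → CommutativeMonoid.refl M) (CommutativeMonoid.refl M)

    private
      _≋_ : Endomorphism → Endomorphism → Set (c ⊔ ℓ)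
      f ≋ g = ∀ x → apply f x ≈ apply g x

      _⊞_ _⊡_ : Endomorphism → Endomorphism → Endomorphism
      f ⊞ g = endomorphism (λ x → apply f x ∙ apply g x) (∙-isHomomorphism f g)
      f ⊡ g = endomorphism (λ x → apply f (apply g x)) (∘-isHomomorphism f g)

      𝟘 𝟙 : Endomorphism
      𝟘 = endomorphism (λ _ → ε) ε-isHomomorphism
      𝟙 = endomorphism (λ x → x) id-isHomomorphism

      abstract
        isSemiring : IsSemiring _≋_ _⊞_ _⊡_ 𝟘 𝟙
        isSemiring = record
          { isSemiringWithoutAnnihilatingZero = record
            { +-isCommutativeMonoid = record
              { isMonoid = record
                { isSemigroup = record
                  { isMagma = record
                    { isEquivalence = record
                      { refl = λ _ → CommutativeMonoid.refl M
                      ; sym = λ f≈g x → CommutativeMonoid.sym M (f≈g x)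
                      ; trans = λ f≈g g≈h x → CommutativeMonoid.trans M (f≈g x) (g≈h x)
                      }
                    ; ∙-cong = λ f≈g h≈k x → ∙-cong (f≈g x) (h≈k x)
                    }
                  ; assoc = λ f g h x → assoc _ _ _
                  }
                ; identity = (λ f x → identityˡ _) , (λ f x → identityʳ _)
                }
              ; comm = λ f g x → comm _ _
              }
            ; *-cong = λ {f} {g} {h} {k} f≈g h≈k x →
                CommutativeMonoid.trans M (⟦⟧-cong f (h≈k x)) (f≈g (apply k x))
            ; *-assoc = λ f g h x → CommutativeMonoid.refl M
            ; *-identity = (λ f x → CommutativeMonoid.refl M) , (λ f x → CommutativeMonoid.refl M)
            ; distrib = (λ f g h x → homo f _ _) , (λ f g h x → CommutativeMonoid.refl M)
            }
          ; zero = (λ f x → CommutativeMonoid.refl M) , (λ f x → ε-homo f)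
          }

    endomorphismSemiring : Semiring (c ⊔ ℓ) (c ⊔ ℓ)
    endomorphismSemiring = record { isSemiring = isSemiring }

  prime∤! : ∀ {p} → Prime p → ∀ k → k ℕ.< p → ¬ p ℕ∣.∣ k !
  prime∤! {p} pr zero k<p p∣1 = ℕₚ.<-irrefl (sym (ℕ∣.∣1⇒≡1 p∣1)) (ℕ.nonTrivial⇒n>1 p {{prime⇒nonTrivial pr}})
  prime∤! pr (suc k) k<p p∣ with euclidsLemma (suc k) (k !) pr p∣
  ... | inj₁ p∣k = ℕ∣.>⇒∤ k<p p∣k
  ... | inj₂ p∣k! = prime∤! pr k (ℕₚ.<-trans (ℕₚ.n<1+n k) k<p) p∣k!

  -- `p` divides `p !`, which is the binomial coefficient times `k !` times `(p ∸ k) !`, and `p`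
  -- divides neither factorial because both arguments are below `p`.
  prime∣C : ∀ {p} → Prime p → ∀ {k} → 0 ℕ.< k → k ℕ.< p → p ℕ∣.∣ p C k
  prime∣C {p@(suc p-1)} pr {k} 0<k k<p with euclidsLemma (p C k) (k ! ℕ.* (p ℕ.∸ k) !) pr p∣product
    where
    instance _ = k ℕₚ.!* (p ℕ.∸ k) !≢0
    product≡ : (p C k) ℕ.* (k ! ℕ.* (p ℕ.∸ k) !) ≡ p !
    product≡ = trans (cong (ℕ._* (k ! ℕ.* (p ℕ.∸ k) !)) (nCk≡n!/k![n-k]! (ℕₚ.<⇒≤ k<p)))
                     (m/n*n≡m (k![n∸k]!∣n! (ℕₚ.<⇒≤ k<p)))
    p∣product : p ℕ∣.∣ (p C k) ℕ.* (k ! ℕ.* (p ℕ.∸ k) !)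
    p∣product = subst (p ℕ∣.∣_) (sym product≡) (ℕ∣.m∣m*n (p-1 !))
  ... | inj₁ p∣C = p∣C
  ... | inj₂ p∣kk with euclidsLemma (k !) ((p ℕ.∸ k) !) pr p∣kk
  ... | inj₁ p∣k! = contradiction p∣k! (prime∤! pr k k<p)
  ... | inj₂ p∣! = contradiction p∣! (prime∤! pr (p ℕ.∸ k) (ℕₚ.∸-monoʳ-< 0<k (ℕₚ.<⇒≤ k<p)))

  module Frobenius {a ℓ} (S : Semiring a ℓ) {p : ℕ} (p-prime : Prime p) where
    open Semiring S hiding (zero; refl; sym) renaming (trans to ≈-trans)
    open import Algebra.Properties.Semiring.Sum S
    open import Algebra.Properties.Semiring.Mult S
    open import Algebra.Properties.Semiring.Exp S
    open import Algebra.Properties.Semiring.Binomial S using (binomialTerm; theorem)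
    open import Relation.Binary.Reasoning.Setoid setoid

    -- In the binomial theorem for commuting elements every coefficient except the outer two is a
    -- multiple of `p`, and such multiples vanish by `char`.
    frobenius : (∀ z → p × z ≈ 0#) → ∀ x y → x * y ≈ y * x → (x + y) ^ p ≈ x ^ p + y ^ p
    frobenius char x y xy≈yx = go p refl
      where
      multiple≈0 : ∀ {n} → p ℕ∣.∣ n → ∀ z → n × z ≈ 0#
      multiple≈0 (ℕ∣.divides k refl) z = begin
        (k ℕ.* p) × z ≈⟨ ×-assocˡ z k p ⟨
        k × (p × z) ≈⟨ ×-congʳ k (char z) ⟩
        k × 0# ≈⟨ sum-replicate k ⟨
        sum {k} (λ _ → 0#) ≈⟨ sum-replicate-zero k ⟩
        0# ∎
      -- The exponent is a variable equal to `p` so that it can be matched as a successor, which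
      -- exposes the first and the last binomial term.
      go : ∀ n → n ≡ p → (x + y) ^ n ≈ x ^ n + y ^ n
      go zero refl = contradiction (ℕ.nonTrivial⇒n>1 0 {{prime⇒nonTrivial p-prime}}) λ()
      go n@(suc m) refl = begin
        (x + y) ^ n                                        ≈⟨ theorem x y xy≈yx n ⟩
        t zero + sum {n} (λ i → t (suc i))                 ≈⟨ +-cong first (sum-init-last {m} (λ i → t (suc i))) ⟩
        y ^ n + (sum {m} (λ i → t (suc (inject₁ i))) + t (suc (fromℕ m)))
          ≈⟨ +-congˡ (+-cong (sum-cong-≋ {m} middle) last≈) ⟩
        y ^ n + (sum {m} (λ _ → 0#) + x ^ n)               ≈⟨ +-congˡ (+-congʳ (sum-replicate-zero m)) ⟩
        y ^ n + (0# + x ^ n)                               ≈⟨ +-congˡ (+-identityˡ _) ⟩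
        y ^ n + x ^ n                                      ≈⟨ +-comm _ _ ⟩
        x ^ n + y ^ n                                      ∎
        where
        t = binomialTerm x y n
        first : t zero ≈ y ^ n
        first = ≈-trans (×-homo-1 _) (*-identityˡ _)
        last≈ : t (suc (fromℕ m)) ≈ x ^ n
        last≈ rewrite toℕ-fromℕ m | nCn≡1 n | ℕₚ.n∸n≡0 m = ≈-trans (×-homo-1 _) (*-identityʳ _)
        middle : ∀ (i : Fin m) → t (suc (inject₁ i)) ≈ 0#
        middle i = multiple≈0 (prime∣C p-prime (s≤s z≤n)
          (s≤s (subst (ℕ._< m) (sym (toℕ-inject₁ i)) (toℕ<n i)))) _

module Proof where
  open OperatorSemirings
  open import Defs
  open import Level using (0ℓ)
  open import Algebra.Bundles using (CommutativeMonoid; Semiring)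
  import Algebra.Construct.Pointwise as Pointwise
  open import Data.Empty using (⊥)
  open import Data.Fin using (Fin; toℕ; fromℕ<; remQuot; combine)
  open import Data.Fin.Properties using
    (pigeonhole; toℕ<n; toℕ-injective; fromℕ<-injective; combine-remQuot)
    renaming (<⇒≢ to <⇒≢-Fin)
  open import Data.Integer using (ℤ; +_; -[1+_]; -_; _+_; _*_; _-_; _^_; ∣_∣; 0ℤ; 1ℤ; -1ℤ)
  open import Data.Integer.Divisibility.Signed
  open import Data.Integer.DivMod using (_%ℕ_; _/ℕ_; n%ℕd<d; a≡a%ℕn+[a/ℕn]*n)
  open import Data.Integer.Properties
  open import Data.Integer.Tactic.RingSolver using (solve-∀)
  open import Data.List using (List; []; _∷_; _++_; length)
  open import Data.List.Properties using (length-++)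
  open import Data.List.Relation.Binary.Permutation.Propositional.Properties using (↭-length)
  open import Data.List.Relation.Unary.All using (All; []; _∷_)
  open import Data.List.Relation.Unary.All.Properties using (++⁺)
  open import Data.Nat as ℕ using (ℕ; zero; suc; NonZero; z≤n; s≤s)
  open import Data.Nat.Coprimality as Coprimality using (Coprime)
  import Data.Nat.Divisibility as ℕ∣
  open import Data.Nat.DivMod using (m≡m%n+[m/n]*n; m%n<n; m<n⇒m%n≡m)
  open import Data.Nat.GCD using (module Bézout)
  open import Data.Nat.ListAction using (product)
  open import Data.Nat.ListAction.Properties using (product-++)
  open import Data.Nat.Primality using
    (Prime; ¬prime[1]; prime[2]; euclidsLemma; prime⇒nonTrivial; prime⇒nonZero; prime⇒irreducible; productOfPrimes≢0)
  open import Data.Nat.Primality.Factorisation using (PrimeFactorisation; factorise; factorisationUnique)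
  open PrimeFactorisation
  import Data.Nat.Properties as ℕₚ
  import Data.Nat.Tactic.RingSolver as ℕ-Solver
  open import Data.Product using (_×_; ∃; ∃₂; _,_; proj₁; proj₂)
  open import Data.Sum using (_⊎_; inj₁; inj₂; [_,_]′)
  open import Function using (_∘_)
  open import Relation.Binary.Definitions using (tri<; tri≈; tri>)
  open import Relation.Binary.PropositionalEquality using
    (_≡_; _≢_; refl; sym; trans; cong; cong₂; subst; subst₂; module ≡-Reasoning)
  open import Relation.Nullary using (¬_; contradiction; yes; no)
  open import Relation.Nullary.Decidable using (_×-dec_)

  -- Congruences and sums over a period

  infix 4 _≡_[mod_]

  -- A record rather than a synonym, so that x and y are inferable from x ≡ y [mod m ].
  record _≡_[mod_] (x y : ℤ) (m : ℕ) : Set where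
    constructor ∣⇒mod
    field mod⇒∣ : + m ∣ x - y

  open _≡_[mod_]

  module _ {m : ℕ} where
    mod-reflexive : ∀ {x y} → x ≡ y → x ≡ y [mod m ]
    mod-reflexive {x} refl = ∣⇒mod (divides 0ℤ (+-inverseʳ x))

    mod-refl : ∀ {x} → x ≡ x [mod m ]
    mod-refl = mod-reflexive refl

    mod-sym : ∀ {x y} → x ≡ y [mod m ] → y ≡ x [mod m ]
    mod-sym {x} {y} (∣⇒mod p) = ∣⇒mod (subst (+ m ∣_) (identity x y) (∣m⇒∣-m p))
      where
      identity : ∀ x y → - (x - y) ≡ y - x
      identity = solve-∀

    mod-trans : ∀ {x y z} → x ≡ y [mod m ] → y ≡ z [mod m ] → x ≡ z [mod m ]
    mod-trans {x} {y} {z} (∣⇒mod p) (∣⇒mod q) = ∣⇒mod (subst (+ m ∣_) (identity x y z) (∣m∣n⇒∣m+n p q))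
      where
      identity : ∀ x y z → (x - y) + (y - z) ≡ x - z
      identity = solve-∀

    mod-+-cong : ∀ {x y u v} → x ≡ y [mod m ] → u ≡ v [mod m ] → x + u ≡ y + v [mod m ]
    mod-+-cong {x} {y} {u} {v} (∣⇒mod p) (∣⇒mod q) = ∣⇒mod (subst (+ m ∣_) (identity x y u v) (∣m∣n⇒∣m+n p q))
      where
      identity : ∀ x y u v → (x - y) + (u - v) ≡ (x + u) - (y + v)
      identity = solve-∀

    mod-*-congˡ : ∀ c {x y} → x ≡ y [mod m ] → c * x ≡ c * y [mod m ]
    mod-*-congˡ c {x} {y} (∣⇒mod p) = ∣⇒mod (subst (+ m ∣_) (identity c x y) (∣n⇒∣m*n c p))
      where
      identity : ∀ c x y → c * (x - y) ≡ c * x - c * y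
      identity = solve-∀

    mod-*-congʳ : ∀ c {x y} → x ≡ y [mod m ] → x * c ≡ y * c [mod m ]
    mod-*-congʳ c {x} {y} (∣⇒mod p) = ∣⇒mod (subst (+ m ∣_) (identity c x y) (∣m⇒∣m*n c p))
      where
      identity : ∀ c x y → (x - y) * c ≡ x * c - y * c
      identity = solve-∀

    mod-neg-cong : ∀ {x y} → x ≡ y [mod m ] → - x ≡ - y [mod m ]
    mod-neg-cong {x} {y} (∣⇒mod p) = ∣⇒mod (subst (+ m ∣_) (identity x y) (∣m⇒∣-m p))
      where
      identity : ∀ x y → - (x - y) ≡ - x - - y
      identity = solve-∀

    mod-minus-congˡ : ∀ c {x y} → x ≡ y [mod m ] → c - x ≡ c - y [mod m ]
    mod-minus-congˡ c p = mod-+-cong (mod-refl {c}) (mod-neg-cong p)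

    mod-minus-congʳ : ∀ c {x y} → x ≡ y [mod m ] → x - c ≡ y - c [mod m ]
    mod-minus-congʳ c p = mod-+-cong p (mod-refl { - c})

    ∣⇒≡0-mod : ∀ {x} → + m ∣ x → x ≡ 0ℤ [mod m ]
    ∣⇒≡0-mod {x} p = ∣⇒mod (subst (+ m ∣_) (sym (+-identityʳ x)) p)

    ∣-resp-mod : ∀ {x y} → x ≡ y [mod m ] → + m ∣ x → + m ∣ y
    ∣-resp-mod {x} {y} (∣⇒mod p) q = ∣m+n∣m⇒∣n (subst (+ m ∣_) (identity x y) q) p
      where
      identity : ∀ x y → x ≡ (x - y) + y
      identity = solve-∀

  small-multiple : ∀ {m n} → m ℕ∣.∣ n → n ℕ.< m → n ≡ 0
  small-multiple {n = zero} _ _ = refl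
  small-multiple {n = suc n} m∣n n<m = contradiction m∣n (ℕ∣.>⇒∤ n<m)

  ∣-∣<  : ∀ {m x y} → x ℕ.< m → y ℕ.< m → ∣ + x - + y ∣ ℕ.< m
  ∣-∣< {m} {x} {y} x<m y<m rewrite m-n≡m⊖n x y with ℕₚ.≤-total x y
  ... | inj₁ x≤y rewrite ∣⊖∣-≤ x≤y = ℕₚ.≤-<-trans (ℕₚ.m∸n≤m y x) y<m
  ... | inj₂ y≤x rewrite ∣m⊖n∣≡∣n⊖m∣ x y | ∣⊖∣-≤ y≤x = ℕₚ.≤-<-trans (ℕₚ.m∸n≤m x y) x<m

  mod-injective-< : ∀ {m x y} → x ℕ.< m → y ℕ.< m → + x ≡ + y [mod m ] → x ≡ y
  mod-injective-< {m} {x} {y} x<m y<m x≡y =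
    +-injective (i-j≡0⇒i≡j (+ x) (+ y) (∣i∣≡0⇒i≡0 (small-multiple (∣⇒∣ᵤ (mod⇒∣ x≡y)) (∣-∣< x<m y<m))))

  mod-%ℕ : ∀ m .{{_ : NonZero m}} x → + (x %ℕ m) ≡ x [mod m ]
  mod-%ℕ m x = ∣⇒mod (divides (- (x /ℕ m))
    (trans (cong (λ y → + (x %ℕ m) - y) (a≡a%ℕn+[a/ℕn]*n x m)) (identity (+ (x %ℕ m)) (x /ℕ m) (+ m))))
    where
    identity : ∀ r d m → r - (r + d * m) ≡ - d * m
    identity = solve-∀

  %ℕ-cong : ∀ {m} .{{_ : NonZero m}} {x y} → x ≡ y [mod m ] → x %ℕ m ≡ y %ℕ m
  %ℕ-cong {m} {x} {y} x≡y = mod-injective-< (n%ℕd<d x m) (n%ℕd<d y m)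
    (mod-trans (mod-%ℕ m x) (mod-trans x≡y (mod-sym (mod-%ℕ m y))))

  euclid-ℤ : ∀ {p} → Prime p → ∀ x y → + p ∣ x * y → (+ p ∣ x) ⊎ (+ p ∣ y)
  euclid-ℤ pr x y p∣xy with euclidsLemma ∣ x ∣ ∣ y ∣ pr (subst (_ ℕ∣.∣_) (abs-* x y) (∣⇒∣ᵤ p∣xy))
  ... | inj₁ p∣x = inj₁ (∣ᵤ⇒∣ p∣x)
  ... | inj₂ p∣y = inj₂ (∣ᵤ⇒∣ p∣y)

  -- Bézout over ℕ comes in two forms, according to which side carries the extra 1; the inverse is
  -- the coefficient of `n` in the first and its negative in the second.
  coprime-inverse : ∀ {m n} → Coprime n m → ∃ λ w → + n * w ≡ 1ℤ [mod m ]
  coprime-inverse {m} {n} c with Coprimality.coprime-Bézout c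
  ... | Bézout.+- x y eq = + x , ∣⇒mod (divides (+ y) (trans (cong (_- 1ℤ) lift) (identity (+ y * + m))))
    where
    open ≡-Reasoning
    lift : + n * + x ≡ 1ℤ + + y * + m
    lift = begin
      + n * + x          ≡⟨ *-comm (+ n) (+ x) ⟩
      + x * + n          ≡⟨ pos-* x n ⟨
      + (x ℕ.* n)        ≡⟨ cong +_ eq ⟨
      1ℤ + + (y ℕ.* m)   ≡⟨ cong (λ z → 1ℤ + z) (pos-* y m) ⟩
      1ℤ + + y * + m     ∎
    identity : ∀ z → 1ℤ + z - 1ℤ ≡ z
    identity = solve-∀
  ... | Bézout.-+ x y eq = - (+ x) , ∣⇒mod (divides (- (+ y))
    (trans (identity (+ n) (+ x)) (trans (cong -_ lift) (neg-distribˡ-* (+ y) (+ m)))))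
    where
    open ≡-Reasoning
    lift : 1ℤ + + x * + n ≡ + y * + m
    lift = begin
      1ℤ + + x * + n     ≡⟨ cong (λ z → 1ℤ + z) (pos-* x n) ⟨
      + (1 ℕ.+ x ℕ.* n)  ≡⟨ cong +_ eq ⟩
      + (y ℕ.* m)        ≡⟨ pos-* y m ⟩
      + y * + m          ∎
    identity : ∀ n x → n * - x - 1ℤ ≡ - (1ℤ + x * n)
    identity = solve-∀

  inverse : ∀ {p} → Prime p → ∀ u → ¬ + p ∣ u → ∃ λ w → u * w ≡ 1ℤ [mod p ]
  inverse {p} pr u p∤u = w , mod-trans (mod-*-congʳ w (mod-sym (mod-%ℕ p u))) uw≡1
    where
    instance _ = prime⇒nonZero pr
    r = u %ℕ p
    coprime : Coprime r p
    coprime {d} (d∣r , d∣p) with prime⇒irreducible pr d∣p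
    ... | inj₁ d≡1 = d≡1
    ... | inj₂ refl = contradiction (∣-resp-mod (mod-%ℕ p u) (∣ᵤ⇒∣ d∣r)) p∤u
    w = proj₁ (coprime-inverse coprime)
    uw≡1 = proj₂ (coprime-inverse coprime)

  ∑< : ℕ → (ℤ → ℤ) → ℤ
  ∑< zero    f = 0ℤ
  ∑< (suc m) f = ∑< m f + f (+ m)

  ∑-cong : ∀ m {f g} → (∀ x → f x ≡ g x) → ∑< m f ≡ ∑< m g
  ∑-cong zero    f≗g = refl
  ∑-cong (suc m) f≗g = cong₂ _+_ (∑-cong m f≗g) (f≗g (+ m))

  ∑-zero : ∀ m → ∑< m (λ _ → 0ℤ) ≡ 0ℤ
  ∑-zero zero    = refl
  ∑-zero (suc m) = trans (+-identityʳ _) (∑-zero m)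

  ∑-+ : ∀ m f g → ∑< m (λ x → f x + g x) ≡ ∑< m f + ∑< m g
  ∑-+ zero    f g = refl
  ∑-+ (suc m) f g = trans (cong (_+ (f (+ m) + g (+ m))) (∑-+ m f g))
                          (identity (∑< m f) (∑< m g) (f (+ m)) (g (+ m)))
    where
    identity : ∀ a b c d → a + b + (c + d) ≡ a + c + (b + d)
    identity = solve-∀

  ∑-*ˡ : ∀ m c f → ∑< m (λ x → c * f x) ≡ c * ∑< m f
  ∑-*ˡ zero    c f = sym (*-zeroʳ c)
  ∑-*ˡ (suc m) c f = trans (cong (_+ c * f (+ m)) (∑-*ˡ m c f)) (sym (*-distribˡ-+ c _ _))

  ∑-const : ∀ m c → ∑< m (λ _ → c) ≡ + m * c
  ∑-const zero    c = refl
  ∑-const (suc m) c = trans (cong (_+ c) (∑-const m c)) (identity (+ m) c)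
    where
    identity : ∀ m c → m * c + c ≡ (1ℤ + m) * c
    identity = solve-∀

  ∑-swap : ∀ m n (f : ℤ → ℤ → ℤ) → ∑< m (λ x → ∑< n (f x)) ≡ ∑< n (λ y → ∑< m (λ x → f x y))
  ∑-swap zero    n f = sym (∑-zero n)
  ∑-swap (suc m) n f = trans (cong (_+ ∑< n (f (+ m))) (∑-swap m n f))
                             (sym (∑-+ n (λ y → ∑< m (λ x → f x y)) (f (+ m))))

  ∑-vanish : ∀ m f → (∀ k → k ℕ.< m → f (+ k) ≡ 0ℤ) → ∑< m f ≡ 0ℤ
  ∑-vanish zero    f f≡0 = refl
  ∑-vanish (suc m) f f≡0 = cong₂ _+_ (∑-vanish m f (λ k k<m → f≡0 k (ℕₚ.m<n⇒m<1+n k<m))) (f≡0 m ℕₚ.≤-refl)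

  ∑-single : ∀ m f r → r ℕ.< m → (∀ k → k ℕ.< m → k ≢ r → f (+ k) ≡ 0ℤ) → ∑< m f ≡ f (+ r)
  ∑-single (suc m) f r r<1+m f≡0 with r ℕ.≟ m
  ... | yes refl = trans (cong (_+ f (+ r)) (∑-vanish m f
                     (λ k k<m → f≡0 k (ℕₚ.m<n⇒m<1+n k<m) (ℕₚ.<⇒≢ k<m))))
                     (+-identityˡ _)
  ... | no r≢m = trans (cong₂ _+_ (∑-single m f r (ℕₚ.≤∧≢⇒< (ℕₚ.≤-pred r<1+m) r≢m)
                                    (λ k k<m → f≡0 k (ℕₚ.m<n⇒m<1+n k<m)))
                                  (f≡0 m ℕₚ.≤-refl (r≢m ∘ sym)))
                       (+-identityʳ _)

  module Periodic (q : ℕ) .{{_ : NonZero q}} where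
    open ≡-Reasoning

    -- Functions on `ℤ/q` are represented by periodic functions on ℤ, so that shifting, scaling and
    -- negating an argument is plain integer arithmetic.
    IsPeriodic : (ℤ → ℤ) → Set
    IsPeriodic f = ∀ {x y} → x ≡ y [mod q ] → f x ≡ f y

    -- The unit of convolution modulo `q`, by `∑-δ`.
    δ : ℤ → ℤ
    δ x with + q ∣? x
    ... | yes _ = 1ℤ
    ... | no  _ = 0ℤ

    δ-∣ : ∀ {x} → + q ∣ x → δ x ≡ 1ℤ
    δ-∣ {x} q∣x with + q ∣? x
    ... | yes _   = refl
    ... | no  q∤x = contradiction q∣x q∤x

    δ-∤ : ∀ {x} → ¬ + q ∣ x → δ x ≡ 0ℤ
    δ-∤ {x} q∤x with + q ∣? x
    ... | yes q∣x = contradiction q∣x q∤x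
    ... | no  _   = refl

    δ-cong : ∀ {x y} → (+ q ∣ x → + q ∣ y) → (+ q ∣ y → + q ∣ x) → δ x ≡ δ y
    δ-cong {x} {y} x⇒y y⇒x with + q ∣? x
    ... | yes q∣x = sym (δ-∣ (x⇒y q∣x))
    ... | no  q∤x = sym (δ-∤ (q∤x ∘ y⇒x))

    -- Only the summand at the residue of `z` survives.
    ∑-δ : ∀ h → IsPeriodic h → ∀ z → ∑< q (λ a → δ (z - a) * h a) ≡ h z
    ∑-δ h periodic z = begin
      ∑< q (λ a → δ (z - a) * h a) ≡⟨ ∑-single q _ r (n%ℕd<d z q) off-diagonal ⟩
      δ (z - + r) * h (+ r)        ≡⟨ cong (_* h (+ r)) (δ-∣ (mod⇒∣ (mod-sym r≡z))) ⟩
      1ℤ * h (+ r)                 ≡⟨ *-identityˡ _ ⟩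
      h (+ r)                      ≡⟨ periodic r≡z ⟩
      h z                          ∎
      where
      r = z %ℕ q
      r≡z = mod-%ℕ q z
      off-diagonal : ∀ k → k ℕ.< q → k ≢ r → δ (z - + k) * h (+ k) ≡ 0ℤ
      off-diagonal k k<q k≢r = trans (cong (_* h (+ k)) (δ-∤ {z - + k} λ z≡k →
        k≢r (mod-injective-< k<q (n%ℕd<d z q) (mod-sym (mod-trans r≡z (∣⇒mod z≡k)))))) (*-zeroˡ (h (+ k)))

    -- Expand h as a combination of delta functions and sum over a first.
    ∑-reindex : ∀ h → IsPeriodic h → (φ ψ : ℤ → ℤ) →
                (∀ a b → φ a ≡ b [mod q ] → ψ b ≡ a [mod q ]) →
                (∀ a b → ψ b ≡ a [mod q ] → φ a ≡ b [mod q ]) →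
                ∑< q (λ a → h (φ a)) ≡ ∑< q h
    ∑-reindex h periodic φ ψ φ⇒ψ ψ⇒φ = begin
      ∑< q (λ a → h (φ a))                          ≡⟨ ∑-cong q (λ a → ∑-δ h periodic (φ a)) ⟨
      ∑< q (λ a → ∑< q (λ b → δ (φ a - b) * h b))   ≡⟨ ∑-swap q q _ ⟩
      ∑< q (λ b → ∑< q (λ a → δ (φ a - b) * h b))
        ≡⟨ ∑-cong q (λ b → ∑-cong q (λ a → cong (_* h b) (δ-cong (mod⇒∣ ∘ φ⇒ψ a b ∘ ∣⇒mod) (mod⇒∣ ∘ ψ⇒φ a b ∘ ∣⇒mod)))) ⟩
      ∑< q (λ b → ∑< q (λ a → δ (ψ b - a) * h b))   ≡⟨ ∑-cong q (λ b → ∑-δ (λ _ → h b) (λ _ → refl) (ψ b)) ⟩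
      ∑< q h                                        ∎

    ∑-translate : ∀ h → IsPeriodic h → ∀ n → ∑< q (λ a → h (a - n)) ≡ ∑< q h
    ∑-translate h periodic n = ∑-reindex h periodic (λ a → a - n) (λ b → b + n)
      (λ a b → ∣⇒mod ∘ subst (+ q ∣_) (identity n a b) ∘ ∣m⇒∣-m ∘ mod⇒∣)
      (λ a b → ∣⇒mod ∘ subst (+ q ∣_) (identity′ n a b) ∘ ∣m⇒∣-m ∘ mod⇒∣)
      where
      identity : ∀ n a b → - (a - n - b) ≡ b + n - a
      identity = solve-∀
      identity′ : ∀ n a b → - (b + n - a) ≡ a - n - b
      identity′ = solve-∀

    ∑-scale : ∀ h → IsPeriodic h → ∀ u w → u * w ≡ 1ℤ [mod q ] → ∑< q (λ a → h (u * a)) ≡ ∑< q h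
    ∑-scale h periodic u w uw≡1 = ∑-reindex h periodic (u *_) (w *_)
      (λ a b p → mod-trans (mod-*-congˡ w (mod-sym p))
         (subst (_≡ a [mod q ]) (identity a u w) (subst (u * w * a ≡_[mod q ]) (*-identityˡ a) (mod-*-congʳ a uw≡1))))
      (λ a b p → mod-trans (mod-*-congˡ u (mod-sym p))
         (subst (_≡ b [mod q ]) (*-assoc u w b) (subst (u * w * b ≡_[mod q ]) (*-identityˡ b) (mod-*-congʳ b uw≡1))))
      where
      identity : ∀ a u w → u * w * a ≡ w * (u * a)
      identity = solve-∀

  -- Gauss sums

  ∤1 : ∀ {p} → Prime p → ¬ + p ∣ 1ℤ
  ∤1 {p} pr p∣1 = ℕₚ.<-irrefl (sym (ℕ∣.∣1⇒≡1 (∣⇒∣ᵤ p∣1))) (ℕ.nonTrivial⇒n>1 p {{prime⇒nonTrivial pr}})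

  integersMod : ℕ → CommutativeMonoid 0ℓ 0ℓ
  integersMod m = record
    { Carrier = ℤ
    ; _≈_ = _≡_[mod m ]
    ; _∙_ = _+_
    ; ε = 0ℤ
    ; isCommutativeMonoid = record
      { isMonoid = record
        { isSemigroup = record
          { isMagma = record
            { isEquivalence = record { refl = mod-refl ; sym = mod-sym ; trans = mod-trans }
            ; ∙-cong = mod-+-cong
            }
          ; assoc = λ x y z → mod-reflexive (+-assoc x y z)
          }
        ; identity = (λ x → mod-reflexive (+-identityˡ x)) , (λ x → mod-reflexive (+-identityʳ x))
        }
      ; comm = λ x y → mod-reflexive (+-comm x y)
      }
    }

  -- The principal character satisfies these axioms too; nontriviality enters separately, through an
  -- element of value -1.
  record IsQuadraticCharacter (q : ℕ) (χ : ℤ → ℤ) : Set where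
    field
      periodic : ∀ {x y} → x ≡ y [mod q ] → χ x ≡ χ y
      multiplicative : ∀ x y → χ (x * y) ≡ χ x * χ y
      vanishes : ∀ {x} → + q ∣ x → χ x ≡ 0ℤ
      involutive : ∀ {x} → ¬ + q ∣ x → χ x * χ x ≡ 1ℤ

  module Gauss {q : ℕ} (q-prime : Prime q) {χ : ℤ → ℤ} (isχ : IsQuadraticCharacter q χ) where
    open IsQuadraticCharacter isχ
    instance _ = prime⇒nonZero q-prime
    open Periodic q

    χ1≡1 : χ 1ℤ ≡ 1ℤ
    χ1≡1 = trans (multiplicative 1ℤ 1ℤ) (involutive (∤1 q-prime))

    η : ℤ
    η = χ -1ℤ

    χ-neg : ∀ x → χ (- x) ≡ η * χ x
    χ-neg x = trans (cong χ (sym (-1*i≡-i x))) (multiplicative -1ℤ x)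

    χ²≡1-δ : ∀ x → χ x * χ x ≡ 1ℤ - δ x
    χ²≡1-δ x with + q ∣? x
    ... | yes q∣x = trans (cong (λ y → y * χ x) (vanishes q∣x)) (*-zeroˡ (χ x))
    ... | no  q∤x = involutive q∤x

    -- The Gauss sum G as an operator: multiplication by the sum of `χ a` times the a-th power of
    -- the generator in the group ring of `ℤ/q`.
    conv : (ℤ → ℤ) → ℤ → ℤ
    conv f n = ∑< q (λ a → χ a * f (n - a))

    module Nontrivial {g : ℤ} (χg≡-1 : χ g ≡ -1ℤ) where
      open ≡-Reasoning

      -- Replacing `a` by `g * a` permutes the residues and changes the sign of every summand.
      ∑χ≡0 : ∑< q χ ≡ 0ℤ
      ∑χ≡0 = double≡0 (begin
        ∑< q χ                   ≡⟨ ∑-scale χ periodic g w gw≡1 ⟨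
        ∑< q (λ a → χ (g * a))   ≡⟨ ∑-cong q (λ a → trans (multiplicative g a) (cong (_* χ a) χg≡-1)) ⟩
        ∑< q (λ a → -1ℤ * χ a)   ≡⟨ ∑-*ˡ q -1ℤ χ ⟩
        -1ℤ * ∑< q χ             ∎)
        where
        q∤g : ¬ + q ∣ g
        q∤g q∣g with () ← trans (sym (vanishes q∣g)) χg≡-1
        w = proj₁ (inverse q-prime g q∤g)
        gw≡1 = proj₂ (inverse q-prime g q∤g)
        double≡0 : ∀ {x} → x ≡ -1ℤ * x → x ≡ 0ℤ
        double≡0 {+ zero}  _ = refl
        double≡0 {+ suc n} ()

      -- The Jacobi sum of `χ` with itself.
      J : ℤ
      J = conv χ 1ℤ

      -- The substitution of `c * a` for `a` pulls out `χ c` twice, and `χ c * χ c` is 1.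
      conv-unit : ∀ {c} → ¬ + q ∣ c → conv χ c ≡ J
      conv-unit {c} q∤c = begin
        ∑< q (λ a → χ a * χ (c - a))
          ≡⟨ ∑-scale (λ a → χ a * χ (c - a)) h-periodic c w cw≡1 ⟨
        ∑< q (λ a → χ (c * a) * χ (c - c * a))  ≡⟨ ∑-cong q pull-out ⟩
        J                                       ∎
        where
        w = proj₁ (inverse q-prime c q∤c)
        cw≡1 = proj₂ (inverse q-prime c q∤c)
        h-periodic : IsPeriodic (λ a → χ a * χ (c - a))
        h-periodic {x} {y} x≡y = cong₂ _*_ (periodic x≡y) (periodic (mod-minus-congˡ c x≡y))
        factor : ∀ c a → c - c * a ≡ c * (1ℤ - a)
        factor = solve-∀
        regroup : ∀ c a b → c * a * (c * b) ≡ c * c * (a * b)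
        regroup = solve-∀
        pull-out : ∀ a → χ (c * a) * χ (c - c * a) ≡ χ a * χ (1ℤ - a)
        pull-out a = begin
          χ (c * a) * χ (c - c * a)             ≡⟨ cong₂ _*_ (multiplicative c a)
                                                    (trans (cong χ (factor c a)) (multiplicative c (1ℤ - a))) ⟩
          χ c * χ a * (χ c * χ (1ℤ - a))        ≡⟨ regroup (χ c) (χ a) (χ (1ℤ - a)) ⟩
          χ c * χ c * (χ a * χ (1ℤ - a))        ≡⟨ cong (_* (χ a * χ (1ℤ - a))) (involutive q∤c) ⟩
          1ℤ * (χ a * χ (1ℤ - a))               ≡⟨ *-identityˡ _ ⟩
          χ a * χ (1ℤ - a)                      ∎

      ∑1-δ : ∑< q (λ a → 1ℤ - δ a) ≡ + q - 1ℤ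
      ∑1-δ = begin
        ∑< q (λ a → 1ℤ - δ a)                    ≡⟨ ∑-cong q (λ a → cong (λ y → 1ℤ + y) (sym (-1*i≡-i (δ a)))) ⟩
        ∑< q (λ a → 1ℤ + -1ℤ * δ a)              ≡⟨ ∑-+ q (λ _ → 1ℤ) (λ a → -1ℤ * δ a) ⟩
        ∑< q (λ _ → 1ℤ) + ∑< q (λ a → -1ℤ * δ a) ≡⟨ cong₂ _+_ (trans (∑-const q 1ℤ) (*-identityʳ (+ q))) (∑-*ˡ q -1ℤ δ) ⟩
        + q + -1ℤ * ∑< q δ                       ≡⟨ cong (λ y → + q + -1ℤ * y) ∑δ≡1 ⟩
        + q - 1ℤ                                 ∎
        where
        ∑δ≡1 : ∑< q δ ≡ 1ℤ
        ∑δ≡1 = trans (∑-cong q (λ a → trans (δ-cong (subst (+ q ∣_) (sym (+-identityˡ (- a))) ∘ ∣m⇒∣-m)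
                                               (subst (+ q ∣_) (identity a) ∘ ∣m⇒∣-m)) (sym (*-identityʳ _))))
                     (∑-δ (λ _ → 1ℤ) (λ _ → refl) 0ℤ)
          where
          identity : ∀ a → - (0ℤ - a) ≡ a
          identity = solve-∀

      -- Each summand is `η` times the square of `χ a`, which is 1 on the q - 1 units and 0
      -- otherwise.
      conv-0 : conv χ 0ℤ ≡ η * (+ q - 1ℤ)
      conv-0 = begin
        ∑< q (λ a → χ a * χ (0ℤ - a)) ≡⟨ ∑-cong q summand ⟩
        ∑< q (λ a → η * (1ℤ - δ a))   ≡⟨ ∑-*ˡ q η (λ a → 1ℤ - δ a) ⟩
        η * ∑< q (λ a → 1ℤ - δ a)     ≡⟨ cong (η *_) ∑1-δ ⟩
        η * (+ q - 1ℤ)                ∎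
        where
        regroup : ∀ e a → a * (e * a) ≡ e * (a * a)
        regroup = solve-∀
        summand : ∀ a → χ a * χ (0ℤ - a) ≡ η * (1ℤ - δ a)
        summand a = begin
          χ a * χ (0ℤ - a)   ≡⟨ cong (λ y → χ a * y) (trans (cong χ (+-identityˡ (- a))) (χ-neg a)) ⟩
          χ a * (η * χ a)    ≡⟨ regroup η (χ a) ⟩
          η * (χ a * χ a)    ≡⟨ cong (η *_) (χ²≡1-δ a) ⟩
          η * (1ℤ - δ a)     ∎

      conv-split : ∀ n → conv χ n ≡ J + (conv χ 0ℤ - J) * δ n
      conv-split n with + q ∣? n
      ... | no q∤n = trans (conv-unit q∤n) (identity J (conv χ 0ℤ))
        where
        identity : ∀ j a → j ≡ j + (a - j) * 0ℤ
        identity = solve-∀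
      ... | yes q∣n = trans (∑-cong q (λ a → cong (λ y → χ a * y)
          (periodic (mod-minus-congʳ a (∣⇒≡0-mod q∣n))))) (identity J (conv χ 0ℤ))
        where
        identity : ∀ j a → a ≡ j + (a - j) * 1ℤ
        identity = solve-∀

      -- Sum conv χ over a period: the total (∑ χ)² is 0.
      J≡-η : J ≡ - η
      J≡-η = [ q≡1-absurd , (λ J+η≡0 → i-j≡0⇒i≡j J (- η) (trans (cong (λ y → J + y) (neg-involutive η)) J+η≡0)) ]′
             (i*j≡0⇒i≡0∨j≡0 (+ q - 1ℤ) product≡0)
        where
        total : ∑< q (conv χ) ≡ 0ℤ
        total = begin
          ∑< q (λ n → ∑< q (λ a → χ a * χ (n - a))) ≡⟨ ∑-swap q q (λ n a → χ a * χ (n - a)) ⟩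
          ∑< q (λ a → ∑< q (λ n → χ a * χ (n - a))) ≡⟨ ∑-cong q (λ a → ∑-*ˡ q (χ a) (λ n → χ (n - a))) ⟩
          ∑< q (λ a → χ a * ∑< q (λ n → χ (n - a))) ≡⟨ ∑-cong q (λ a → cong (χ a *_) (trans (∑-translate χ periodic a) ∑χ≡0)) ⟩
          ∑< q (λ a → χ a * 0ℤ)                     ≡⟨ ∑-cong q (λ a → *-zeroʳ (χ a)) ⟩
          ∑< q (λ _ → 0ℤ)                           ≡⟨ ∑-zero q ⟩
          0ℤ                                        ∎
        A = conv χ 0ℤ
        split-total : ∑< q (conv χ) ≡ + q * J + (A - J) * 1ℤ
        split-total = begin
          ∑< q (conv χ)                                  ≡⟨ ∑-cong q split ⟩
          -- `A` everywhere plus a correction `J - A` on the units, which `∑1-δ` counts.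
          ∑< q (λ n → A + (J - A) * (1ℤ - δ n))          ≡⟨ ∑-+ q (λ _ → A) _ ⟩
          ∑< q (λ _ → A) + ∑< q (λ n → (J - A) * (1ℤ - δ n)) ≡⟨ cong₂ _+_ (∑-const q A)
                                                              (trans (∑-*ˡ q (J - A) _) (cong ((J - A) *_) ∑1-δ)) ⟩
          + q * A + (J - A) * (+ q - 1ℤ)                 ≡⟨ identity (+ q) A J ⟩
          + q * J + (A - J) * 1ℤ                         ∎
          where
          identity : ∀ q a j → q * a + (j - a) * (q - 1ℤ) ≡ q * j + (a - j) * 1ℤ
          identity = solve-∀
          rearrange : ∀ j a d → j + (a - j) * d ≡ a + (j - a) * (1ℤ - d)
          rearrange = solve-∀
          split : ∀ n → conv χ n ≡ A + (J - A) * (1ℤ - δ n)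
          split n = trans (conv-split n) (rearrange J A (δ n))
        -- With `conv-0` in place of `A` the total becomes this product, and q ≠ 1 leaves only the
        -- second factor to vanish.
        product≡0 : (+ q - 1ℤ) * (J + η) ≡ 0ℤ
        product≡0 = begin
          (+ q - 1ℤ) * (J + η)                         ≡⟨ identity (+ q) J η ⟩
          + q * J + (η * (+ q - 1ℤ) - J) * 1ℤ          ≡⟨ cong (λ a → + q * J + (a - J) * 1ℤ) conv-0 ⟨
          + q * J + (A - J) * 1ℤ                       ≡⟨ split-total ⟨
          ∑< q (conv χ)                                ≡⟨ total ⟩
          0ℤ                                           ∎
          where
          identity : ∀ q j e → (q - 1ℤ) * (j + e) ≡ q * j + (e * (q - 1ℤ) - j) * 1ℤ
          identity = solve-∀
        q≡1-absurd : + q - 1ℤ ≡ 0ℤ → J ≡ - η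
        q≡1-absurd q≡1 = contradiction (subst Prime (+-injective (i-j≡0⇒i≡j (+ q) 1ℤ q≡1)) q-prime) ¬prime[1]

      conv-χ : ∀ n → conv χ n ≡ η * + q * δ n - η
      conv-χ n = begin
        conv χ n                                     ≡⟨ conv-split n ⟩
        J + (conv χ 0ℤ - J) * δ n                    ≡⟨ cong₂ (λ j a → j + (a - j) * δ n) J≡-η conv-0 ⟩
        - η + (η * (+ q - 1ℤ) - - η) * δ n           ≡⟨ identity η (+ q) (δ n) ⟩
        η * + q * δ n - η                            ∎
        where
        identity : ∀ e q d → - e + (e * (q - 1ℤ) - - e) * d ≡ e * q * d - e
        identity = solve-∀

      -- This is G³ = ηqG applied to `δ`. By `conv-χ`, G² differs from ηq only by the constant
      -- function `- η`, and one more convolution kills constants because `χ` sums to 0.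
      conv-conv-χ : ∀ n → conv (conv χ) n ≡ η * + q * χ n
      conv-conv-χ n = begin
        ∑< q (λ a → χ a * conv χ (n - a))            ≡⟨ ∑-cong q (λ a → trans (cong (χ a *_) (conv-χ (n - a)))
                                                          (identity (χ a) η (+ q) (δ (n - a)))) ⟩
        ∑< q (λ a → η * + q * (δ (n - a) * χ a) + - η * χ a)
          ≡⟨ ∑-+ q (λ a → η * + q * (δ (n - a) * χ a)) (λ a → - η * χ a) ⟩
        ∑< q (λ a → η * + q * (δ (n - a) * χ a)) + ∑< q (λ a → - η * χ a)
          ≡⟨ cong₂ _+_ (∑-*ˡ q (η * + q) (λ a → δ (n - a) * χ a)) (∑-*ˡ q (- η) χ) ⟩
        η * + q * ∑< q (λ a → δ (n - a) * χ a) + - η * ∑< q χ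
          ≡⟨ cong₂ (λ s t → η * + q * s + - η * t) (∑-δ χ periodic n) ∑χ≡0 ⟩
        η * + q * χ n + - η * 0ℤ                     ≡⟨ identity′ (η * + q * χ n) η ⟩
        η * + q * χ n                                ∎
        where
        identity : ∀ x e q d → x * (e * q * d - e) ≡ e * q * (d * x) + - e * x
        identity = solve-∀
        identity′ : ∀ x e → x + - e * 0ℤ ≡ x
        identity′ = solve-∀

  -- Quadratic reciprocity from the p-th power of the Gauss sum.

  module Reciprocity {q : ℕ} (q-prime : Prime q) {χ : ℤ → ℤ} (isχ : IsQuadraticCharacter q χ)
                     {g : ℤ} (χg≡-1 : χ g ≡ -1ℤ) {p : ℕ} (p-prime : Prime p) where
    open IsQuadraticCharacter isχ
    instance _ = prime⇒nonZero q-prime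
    open Periodic q
    open Gauss q-prime isχ
    open Nontrivial χg≡-1

    -- The two moduli are kept apart: values are compared modulo `p`, while `q` concerns the
    -- arguments and enters only through `χ` and `δ`.
    functionsMod : CommutativeMonoid 0ℓ 0ℓ
    functionsMod = Pointwise.commutativeMonoid ℤ (integersMod p)

    operators : Semiring 0ℓ 0ℓ
    operators = endomorphismSemiring functionsMod

    private module Op = Semiring operators
    open Op using (Carrier) renaming (_≈_ to _≋_)
    open Endomorphism
    import Algebra.Properties.Semiring.Mult operators as Mult
    import Algebra.Properties.Semiring.Exp operators as Exp
    open Frobenius operators p-prime using (frobenius)

    -- A monomial of the Gauss sum: the shift by `k` weighted by `χ (+ k)`.
    T : ℕ → Carrier
    T k = endomorphism (λ f n → χ (+ k) * f (n - + k)) (mkIsHomomorphism functionsMod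
      (λ f≈g n → mod-*-congˡ (χ (+ k)) (f≈g (n - + k)))
      (λ f g n → mod-reflexive (*-distribˡ-+ (χ (+ k)) (f (n - + k)) (g (n - + k))))
      (λ n → mod-reflexive (*-zeroʳ (χ (+ k)))))

    -- Partial Gauss sums, built with the addition of the semiring so that the Frobenius can be
    -- applied one summand at a time; `D q` is the operator G.
    D : ℕ → Carrier
    D zero    = Op.0#
    D (suc m) = D m Op.+ T m

    apply-D : ∀ m f n → apply (D m) f n ≡ ∑< m (λ a → χ a * f (n - a))
    apply-D zero    f n = refl
    apply-D (suc m) f n = cong (_+ χ (+ m) * f (n - + m)) (apply-D m f n)

    apply-× : ∀ k (F : Carrier) f n → apply (k Mult.× F) f n ≡ + k * apply F f n
    apply-× zero    F f n = refl
    apply-× (suc k) F f n = trans (cong (λ y → apply F f n + y) (apply-× k F f n)) (identity (apply F f n) (+ k))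
      where
      identity : ∀ x k → x + k * x ≡ (1ℤ + k) * x
      identity = solve-∀

    characteristic : ∀ F → p Mult.× F ≋ Op.0#
    characteristic F f n = ∣⇒≡0-mod (subst (+ p ∣_) (sym (apply-× p F f n)) (∣m⇒∣m*n (apply F f n) ∣-refl))

    T-comm : ∀ j k → T j Op.* T k ≋ T k Op.* T j
    T-comm j k f n = mod-reflexive (trans (cong (λ y → χ (+ j) * (χ (+ k) * f y)) (shift n (+ j) (+ k)))
                                          (swap (χ (+ j)) (χ (+ k)) (f (n - + k - + j))))
      where
      shift : ∀ n j k → n - j - k ≡ n - k - j
      shift = solve-∀
      swap : ∀ a b c → a * (b * c) ≡ b * (a * c)
      swap = solve-∀

    -- Shifts commute, which supplies the commutation hypothesis of `frobenius` for a partial sum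
    -- and its next monomial.
    D-T-comm : ∀ m k → D m Op.* T k ≋ T k Op.* D m
    D-T-comm zero    k f n = mod-sym (ε-homo (T k) n)
    D-T-comm (suc m) k f n = mod-trans (mod-+-cong (D-T-comm m k f n) (T-comm m k f n))
                                       (mod-sym (homo (T k) (apply (D m) f) (apply (T m) f) n))

    T^ : ∀ k j f n → apply (T k Exp.^ j) f n ≡ χ (+ k) ^ j * f (n - + k * + j)
    T^ k zero    f n = trans (cong f (identity n (+ k))) (sym (*-identityˡ _))
      where
      identity : ∀ n k → n ≡ n - k * 0ℤ
      identity = solve-∀
    T^ k (suc j) f n = trans (cong (λ y → χ (+ k) * y) (T^ k j f (n - + k)))
      (trans (sym (*-assoc (χ (+ k)) (χ (+ k) ^ j) _))
             (cong (λ y → χ (+ k) * χ (+ k) ^ j * f y) (identity n (+ k) (+ j))))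
      where
      identity : ∀ n k j → n - k - k * j ≡ n - k * (1ℤ + j)
      identity = solve-∀

    -- The Frobenius splits off the last monomial, whose p-th power is given by `T^`; induction
    -- treats the rest.
    D^p : ∀ m f n → apply (D m Exp.^ p) f n ≡ ∑< m (λ a → χ a ^ p * f (n - a * + p)) [mod p ]
    D^p zero f n = 0^ p (ℕ.>-nonZero⁻¹ p {{prime⇒nonZero p-prime}})
      where
      0^ : ∀ j → 0 ℕ.< j → apply (Op.0# Exp.^ j) f n ≡ 0ℤ [mod p ]
      0^ (suc j) _ = mod-refl
    D^p (suc m) f n = mod-trans (frobenius characteristic (D m) (T m) (D-T-comm m m) f n)
      (mod-+-cong (D^p m f n) (mod-reflexive (T^ m p f n)))

    double : Carrier
    double = Op.1# Op.+ Op.1#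

    double^ : ∀ j n → apply (double Exp.^ j) (λ _ → 1ℤ) n ≡ (+ 2) ^ j
    double^ zero    n = refl
    double^ (suc j) n = trans (cong₂ _+_ (double^ j n) (double^ j n)) (identity ((+ 2) ^ j))
      where
      identity : ∀ x → x + x ≡ + 2 * x
      identity = solve-∀

    1^ : ∀ j n → apply (Op.1# Exp.^ j) (λ _ → 1ℤ) n ≡ 1ℤ
    1^ zero    n = refl
    1^ (suc j) n = 1^ j n

    -- Fermat's little theorem for base 2 is the same Frobenius applied to 1 + 1 in the operator
    -- semiring and evaluated at the constant function 1.
    fermat-2 : (+ 2) ^ p ≡ + 2 [mod p ]
    fermat-2 = mod-trans (mod-reflexive (sym (double^ p 0ℤ)))
      (mod-trans (frobenius characteristic Op.1# Op.1# (λ _ _ → mod-refl) (λ _ → 1ℤ) 0ℤ)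
                 (mod-reflexive (cong₂ _+_ (1^ p 0ℤ) (1^ p 0ℤ))))

    D-δ : ∀ n → apply (D q) δ n ≡ χ n
    D-δ n = trans (apply-D q δ n) (trans (∑-cong q (λ a → *-comm (χ a) (δ (n - a)))) (∑-δ χ periodic n))

    module _ (ηq≡4 : η * + q ≡ + 4 [mod p ]) where

      -- On multiples of `χ`, G² acts as `η * + q` by `conv-conv-χ`, and the module hypothesis makes
      -- this the square of 2 modulo `p`. Hence `fermat-2` can take the place of Euler's criterion
      -- in `reciprocity`.
      D-D-χ : ∀ c f → (∀ n → f n ≡ c * χ n [mod p ]) → ∀ n → apply (D q) (apply (D q) f) n ≡ + 4 * c * χ n [mod p ]
      D-D-χ c f f≈cχ n =
        mod-trans (⟦⟧-cong (D q) (⟦⟧-cong (D q) f≈cχ) n)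
        (mod-trans (mod-reflexive (trans (apply-D q _ n) (trans (∑-cong q inner) (trans (∑-*ˡ q c _)
            (trans (cong (λ y → c * y) (conv-conv-χ n)) (identity c η (+ q) (χ n)))))))
          (mod-*-congʳ (χ n) (mod-*-congʳ c ηq≡4)))
        where
        identity : ∀ c e q x → c * (e * q * x) ≡ e * q * c * x
        identity = solve-∀
        swap : ∀ a b c → a * (b * c) ≡ b * (a * c)
        swap = solve-∀
        inner : ∀ a → χ a * apply (D q) (λ x → c * χ x) (n - a) ≡ c * (χ a * conv χ (n - a))
        inner a = trans (cong (λ y → χ a * y) (trans (apply-D q _ (n - a))
          (trans (∑-cong q (λ b → swap (χ b) c (χ (n - a - b)))) (∑-*ˡ q c _))))
          (swap (χ a) c (conv χ (n - a)))

      D^odd-δ : ∀ k n → apply (D q Exp.^ suc (k ℕ.* 2)) δ n ≡ (+ 4) ^ k * χ n [mod p ]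
      D^odd-δ zero    n = mod-reflexive (trans (D-δ n) (sym (*-identityˡ _)))
      D^odd-δ (suc k) n = D-D-χ ((+ 4) ^ k) _ (D^odd-δ k) n

      -- Evaluate the p-th power of G, applied to `δ`, at the point `p`. The Frobenius gives 1,
      -- while `D^odd-δ` gives `(+ 4) ^ k * χ (+ p)`. Doubling turns the power of 4 into the p-th
      -- power of 2, which is 2 modulo `p`, so no division by 2 is needed.
      reciprocity : ∀ k → p ≡ suc (k ℕ.* 2) → ¬ + q ∣ + p → + 2 * χ (+ p) ≡ + 2 [mod p ]
      reciprocity k p≡ q∤p = mod-trans (mod-*-congʳ (χ (+ p)) (mod-sym fermat))
        (mod-trans (mod-reflexive (*-assoc (+ 2) ((+ 4) ^ k) (χ (+ p))))
        (mod-*-congˡ (+ 2) (mod-trans (mod-sym (D^odd-δ k (+ p)))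
          (subst (λ j → apply (D q Exp.^ j) δ (+ p) ≡ 1ℤ [mod p ]) p≡
            (mod-trans (D^p q δ (+ p)) (mod-reflexive value))))))
        where
        2^ : ∀ k → (+ 2) ^ (k ℕ.* 2) ≡ (+ 4) ^ k
        2^ zero    = refl
        2^ (suc k) = trans (cong (λ y → + 2 * (+ 2 * y)) (2^ k)) (sym (*-assoc (+ 2) (+ 2) ((+ 4) ^ k)))
        fermat : + 2 * (+ 4) ^ k ≡ + 2 [mod p ]
        fermat = subst (_≡ + 2 [mod p ]) (trans (cong (λ j → (+ 2) ^ j) p≡) (cong (λ y → + 2 * y) (2^ k))) fermat-2
        1^p : ∀ j → 1ℤ ^ j ≡ 1ℤ
        1^p zero    = refl
        1^p (suc j) = trans (*-identityˡ _) (1^p j)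
        -- The argument of `δ` is `(1ℤ - + a) * + p`, and since `q` does not divide `p` it is a
        -- multiple of `q` only for `a` equal to 1.
        zero-at : ∀ a → a ℕ.< q → a ≢ 1 → (χ (+ a)) ^ p * δ (+ p - + a * + p) ≡ 0ℤ
        zero-at a a<q a≢1 = trans (cong (λ y → (χ (+ a)) ^ p * y) (δ-∤ {+ p - + a * + p} (λ q∣ → absurd (euclid-ℤ q-prime (1ℤ - + a) (+ p) (subst (+ q ∣_) (identity (+ p) (+ a)) q∣)))))
                                  (*-zeroʳ ((χ (+ a)) ^ p))
          where
          identity : ∀ p a → p - a * p ≡ (1ℤ - a) * p
          identity = solve-∀
          absurd : (+ q ∣ 1ℤ - + a) ⊎ (+ q ∣ + p) → ⊥
          absurd (inj₁ q∣1-a) = a≢1 (sym (mod-injective-< (ℕ.nonTrivial⇒n>1 q {{prime⇒nonTrivial q-prime}}) a<q (∣⇒mod q∣1-a)))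
          absurd (inj₂ q∣p) = q∤p q∣p
        value : ∑< q (λ a → χ a ^ p * δ (+ p - a * + p)) ≡ 1ℤ
        value = trans (∑-single q _ 1 (ℕ.nonTrivial⇒n>1 q {{prime⇒nonTrivial q-prime}}) zero-at)
          (cong₂ _*_ (trans (cong (_^ p) χ1≡1) (1^p p))
                     (δ-∣ (divides 0ℤ (identity (+ p)))))
          where
          identity : ∀ p → p - 1ℤ * p ≡ 0ℤ * + q
          identity = solve-∀

  -- The Liouville function and the induced character

  -1^-dichotomy : ∀ k → -1ℤ ^ k ≡ 1ℤ ⊎ -1ℤ ^ k ≡ -1ℤ
  -1^-dichotomy zero = inj₁ refl
  -1^-dichotomy (suc k) with -1^-dichotomy k
  ... | inj₁ eq = inj₂ (cong (-1ℤ *_) eq)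
  ... | inj₂ eq = inj₁ (cong (-1ℤ *_) eq)

  -- Abstract, because the type checker must not run the factorisation algorithm.
  abstract
    liouville : ℕ → ℤ
    liouville zero      = 0ℤ
    liouville n@(suc _) = -1ℤ ^ length (factors (factorise n))

    -- This value at 0 lets `liouville-*` hold without side conditions and makes the induced
    -- character vanish on multiples of `q`.
    liouville-0 : liouville 0 ≡ 0ℤ
    liouville-0 = refl

    Liouville≡-liouville : ∀ {n} → 1 ℕ.≤ n → Liouville≡ n (liouville n)
    Liouville≡-liouville {n@(suc _)} _ =
      length (factors f) , (factors f , (factorsPrime f , sym (isFactorisation f)) , refl) , refl
      where
      f : PrimeFactorisation n
      f = factorise n

    -- By unique factorisation any prime factorisation is a permutation of the computed one, so
    -- their lengths agree.
    liouville-product : ∀ {n ps} → All Prime ps → product ps ≡ n → liouville n ≡ -1ℤ ^ length ps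
    liouville-product {zero} {ps} primes eq =
      contradiction eq (ℕ.≢-nonZero⁻¹ (product ps) {{productOfPrimes≢0 primes}})
    liouville-product {n@(suc _)} {ps} primes eq = cong (-1ℤ ^_) (↭-length (factorisationUnique (factorise n)
      (record { factors = ps ; isFactorisation = sym eq ; factorsPrime = primes })))

    liouville-dichotomy : ∀ {n} → 1 ℕ.≤ n → liouville n ≡ 1ℤ ⊎ liouville n ≡ -1ℤ
    liouville-dichotomy {suc n} _ = -1^-dichotomy (length (factors (factorise (suc n))))

  liouville-prime : ∀ {p} → Prime p → liouville p ≡ -1ℤ
  liouville-prime {p} pr = liouville-product (pr ∷ []) (ℕₚ.*-identityʳ p)

  liouville-* : ∀ m n → liouville (m ℕ.* n) ≡ liouville m * liouville n
  liouville-* zero n = trans liouville-0 (sym (trans (cong (_* liouville n) liouville-0) (*-zeroˡ (liouville n))))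
  liouville-* m@(suc _) zero = trans (cong liouville (ℕₚ.*-zeroʳ m))
    (trans liouville-0 (sym (trans (cong (liouville m *_) liouville-0) (*-zeroʳ (liouville m)))))
  liouville-* m@(suc _) n@(suc _) = begin
    liouville (m ℕ.* n)                                  ≡⟨ liouville-product (++⁺ (factorsPrime f) (factorsPrime g)) product≡ ⟩
    -1ℤ ^ length (factors f ++ factors g)                ≡⟨ cong (-1ℤ ^_) (length-++ (factors f)) ⟩
    -1ℤ ^ (length (factors f) ℕ.+ length (factors g))    ≡⟨ ^-distribˡ-+-* -1ℤ (length (factors f)) (length (factors g)) ⟩
    -1ℤ ^ length (factors f) * -1ℤ ^ length (factors g)
      ≡⟨ cong₂ _*_ (liouville-product (factorsPrime f) (sym (isFactorisation f)))
                   (liouville-product (factorsPrime g) (sym (isFactorisation g))) ⟨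
    liouville m * liouville n                            ∎
    where
    open ≡-Reasoning
    f = factorise m
    g = factorise n
    product≡ : product (factors f ++ factors g) ≡ m ℕ.* n
    product≡ = trans (product-++ (factors f) (factors g))
                     (sym (cong₂ ℕ._*_ (isFactorisation f) (isFactorisation g)))

  liouville-square : ∀ {n} → 1 ℕ.≤ n → liouville n * liouville n ≡ 1ℤ
  liouville-square 1≤n with liouville-dichotomy 1≤n
  ... | inj₁ eq = cong₂ _*_ eq eq
  ... | inj₂ eq = cong₂ _*_ eq eq

  prime-divisor : ∀ {n} → 1 ℕ.< n → ∃ λ p → Prime p × p ℕ∣.∣ n
  prime-divisor {n@(suc _)} 1<n = go (factors f) (isFactorisation f) (factorsPrime f)
    where
    f = factorise n
    go : ∀ ps → n ≡ product ps → All Prime ps → ∃ λ p → Prime p × p ℕ∣.∣ n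
    go []       n≡1 _            = contradiction (sym n≡1) (ℕₚ.<⇒≢ 1<n)
    go (p ∷ ps) eq  (p-prime ∷ _) = p , p-prime , subst (p ℕ∣.∣_) (sym eq) (ℕ∣.m∣m*n (product ps))

  -- There are more than `q` pairs `(x , y)` with entries at most `K`, so `u * x - y` takes the same
  -- residue at two of them. The differences of their entries are `s` and, up to sign, `r`.
  thue : ∀ {q} → Prime q → ∀ K → K ℕ.< q → q ℕ.< suc K ℕ.* suc K → ∀ u → ¬ + q ∣ u →
         ∃₂ λ s r → (1 ℕ.≤ s × s ℕ.≤ K) × (1 ℕ.≤ r × r ℕ.≤ K) ×
                    (u * + s ≡ + r [mod q ] ⊎ u * + s ≡ - + r [mod q ])
  thue {q} q-prime K K<q q<[1+K]² u q∤u = from-pigeonhole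
    where
    instance _ = prime⇒nonZero q-prime

    Goal = ∃₂ λ s r → (1 ℕ.≤ s × s ℕ.≤ K) × (1 ℕ.≤ r × r ℕ.≤ K) ×
                      (u * + s ≡ + r [mod q ] ⊎ u * + s ≡ - + r [mod q ])

    from-difference : ∀ s d → 1 ℕ.≤ s → s ℕ.≤ K → ∣ d ∣ ℕ.≤ K → u * + s ≡ d [mod q ] → Goal
    -- A zero numerator would make `q` divide `u * + s`, although `s` is positive and below `q`.
    from-difference s (+ zero) 1≤s s≤K d≤K us≡0 =
      [ (λ q∣u → contradiction q∣u q∤u)
      , (λ q∣s → contradiction (small-multiple (∣⇒∣ᵤ q∣s) (ℕₚ.≤-<-trans s≤K K<q)) (ℕₚ.>⇒≢ 1≤s)) ]′
      (euclid-ℤ q-prime u (+ s) (∣-resp-mod (mod-sym us≡0) (divides 0ℤ refl)))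
    from-difference s (+ suc r)  1≤s s≤K d≤K us≡d = s , suc r , (1≤s , s≤K) , (s≤s z≤n , d≤K) , inj₁ us≡d
    from-difference s (-[1+ r ]) 1≤s s≤K d≤K us≡d = s , suc r , (1≤s , s≤K) , (s≤s z≤n , d≤K) , inj₂ us≡d

    -- The pairs are ordered so that the difference of the first entries is positive; the sign of
    -- the other difference stays open, whence the two cases of the conclusion.
    from-collision : ∀ x y x′ y′ → x ℕ.≤ K → y ℕ.≤ K → y′ ℕ.≤ K → x′ ℕ.< x →
                     u * + x - + y ≡ u * + x′ - + y′ [mod q ] → Goal
    from-collision x y x′ y′ x≤K y≤K y′≤K x′<x (∣⇒mod q∣) =
      from-difference (x ℕ.∸ x′) (+ y - + y′) (ℕₚ.m<n⇒0<n∸m x′<x) (ℕₚ.≤-trans (ℕₚ.m∸n≤m x x′) x≤K)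
        (ℕₚ.≤-pred (∣-∣< (s≤s y≤K) (s≤s y′≤K)))
        (∣⇒mod (subst (+ q ∣_) rearrange q∣))
      where
      identity : ∀ u x y x′ y′ → (u * x - y) - (u * x′ - y′) ≡ u * (x - x′) - (y - y′)
      identity = solve-∀
      rearrange : (u * + x - + y) - (u * + x′ - + y′) ≡ u * + (x ℕ.∸ x′) - (+ y - + y′)
      rearrange = trans (identity u (+ x) (+ y) (+ x′) (+ y′))
        (cong (λ z → u * z - (+ y - + y′)) (trans (m-n≡m⊖n x x′) (⊖-≥ (ℕₚ.<⇒≤ x′<x))))

    residue : Fin (suc K ℕ.* suc K) → ℤ
    residue i = u * + toℕ (proj₁ (remQuot {suc K} (suc K) i)) - + toℕ (proj₂ (remQuot {suc K} (suc K) i))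

    bound : (i : Fin (suc K)) → toℕ i ℕ.≤ K
    bound i = ℕₚ.≤-pred (toℕ<n i)

    from-pigeonhole : Goal
    from-pigeonhole with pigeonhole q<[1+K]² (λ i → fromℕ< (n%ℕd<d (residue i) q))
    ... | i , j , i<j , fi≡fj = cases (ℕₚ.<-cmp (toℕ x) (toℕ x′))
      where
      x = proj₁ (remQuot {suc K} (suc K) i)
      y = proj₂ (remQuot {suc K} (suc K) i)
      x′ = proj₁ (remQuot {suc K} (suc K) j)
      y′ = proj₂ (remQuot {suc K} (suc K) j)
      collision : residue i ≡ residue j [mod q ]
      collision = mod-trans (mod-sym (mod-%ℕ q (residue i)))
        (mod-trans (mod-reflexive (cong +_ (fromℕ<-injective _ _ _ _ fi≡fj)))
                   (mod-%ℕ q (residue j)))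
      cancel : ∀ a b c → (a - b) - (a - c) ≡ c - b
      cancel = solve-∀
      cases : _ → Goal
      cases (tri< x<x′ _ _) = from-collision _ _ _ _ (bound x′) (bound y′) (bound y) x<x′ (mod-sym collision)
      cases (tri> _ _ x′<x) = from-collision _ _ _ _ (bound x) (bound y) (bound y′) x′<x collision
      -- Equal first entries force congruent second entries, equal because both are below `q`; then
      -- the two pairs would coincide.
      cases (tri≈ _ x≡x′ _) = contradiction i≡j (<⇒≢-Fin i<j)
        where
        y≡y′ : toℕ y ≡ toℕ y′
        y≡y′ = sym (mod-injective-< (ℕₚ.≤-<-trans (bound y′) K<q) (ℕₚ.≤-<-trans (bound y) K<q)
          (∣⇒mod (subst (+ q ∣_) (trans (cong (λ z → (u * + toℕ x - + toℕ y) - (u * + z - + toℕ y′)) (sym x≡x′))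
                                         (cancel (u * + toℕ x) (+ toℕ y) (+ toℕ y′)))
                                  (mod⇒∣ collision))))
        i≡j : i ≡ j
        i≡j = trans (sym (combine-remQuot {suc K} (suc K) i))
          (trans (cong₂ combine (toℕ-injective x≡x′) (toℕ-injective y≡y′)) (combine-remQuot {suc K} (suc K) j))

  cancelˡ-of-square : ∀ c {x y} → c * c ≡ 1ℤ → c * x ≡ c * y → x ≡ y
  cancelˡ-of-square c {x} {y} cc≡1 cx≡cy = begin
    x            ≡⟨ *-identityˡ x ⟨
    1ℤ * x       ≡⟨ cong (_* x) cc≡1 ⟨
    c * c * x    ≡⟨ *-assoc c c x ⟩
    c * (c * x)  ≡⟨ cong (c *_) cx≡cy ⟩
    c * (c * y)  ≡⟨ *-assoc c c y ⟨
    c * c * y    ≡⟨ cong (_* y) cc≡1 ⟩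
    1ℤ * y       ≡⟨ *-identityˡ y ⟩
    y            ∎
    where open ≡-Reasoning

  -- Incompatibility of the Liouville function with reciprocity.

  signed-shift-bounds : ∀ {q K} → 7 ℕ.≤ q → 2 ℕ.≤ K → ∀ e → e ≡ 1ℤ ⊎ e ≡ -1ℤ →
                        1 ℕ.< ∣ e * + q - + 4 ∣ × ∣ e * + q - + 4 ∣ ℕ.≤ q ℕ.* K
  signed-shift-bounds {q} {K} 7≤q 2≤K e (inj₁ e≡1) =
    subst (1 ℕ.<_) (sym size) (ℕₚ.m+n≤o⇒m≤o∸n 2 (ℕₚ.≤-trans (ℕₚ.n≤1+n 6) 7≤q)) ,
    subst (ℕ._≤ q ℕ.* K) (sym size) (ℕₚ.≤-trans (ℕₚ.m∸n≤m q 4) (ℕₚ.m≤m*n q K {{ℕ.>-nonZero (ℕₚ.<⇒≤ 2≤K)}}))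
    where
    size : ∣ e * + q - + 4 ∣ ≡ q ℕ.∸ 4
    size = trans (cong (λ x → ∣ x - + 4 ∣) (trans (cong (_* + q) e≡1) (*-identityˡ (+ q))))
      (trans (cong ∣_∣ (m-n≡m⊖n q 4)) (cong ∣_∣ (⊖-≥ (ℕₚ.≤-trans (ℕₚ.m≤m+n 4 3) 7≤q))))
  signed-shift-bounds {q} {K} 7≤q 2≤K e (inj₂ e≡-1) =
    subst (1 ℕ.<_) (sym size) (ℕₚ.≤-trans (ℕₚ.m≤m+n 2 2) (ℕₚ.m≤n+m 4 q)) ,
    subst (ℕ._≤ q ℕ.* K) (sym size) (ℕₚ.≤-trans (ℕₚ.+-monoʳ-≤ q (ℕₚ.≤-trans (ℕₚ.m≤m+n 4 3) 7≤q))
      (ℕₚ.≤-trans (ℕₚ.≤-reflexive q+q≡q*2) (ℕₚ.*-monoʳ-≤ q 2≤K)))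
    where
    q+q≡q*2 : q ℕ.+ q ≡ q ℕ.* 2
    q+q≡q*2 = trans (cong (q ℕ.+_) (sym (ℕₚ.+-identityʳ q))) (ℕₚ.*-comm 2 q)
    identity : ∀ x → -1ℤ * x - + 4 ≡ - (x + + 4)
    identity = solve-∀
    size : ∣ e * + q - + 4 ∣ ≡ q ℕ.+ 4
    size = trans (cong (λ x → ∣ x * + q - + 4 ∣) e≡-1)
      (trans (cong ∣_∣ (identity (+ q))) (∣-i∣≡∣i∣ (+ (q ℕ.+ 4))))

  square≡1 : ∀ {x} → x * x ≡ 1ℤ → x ≡ 1ℤ ⊎ x ≡ -1ℤ
  square≡1 {x} xx≡1 with i*j≡0⇒i≡0∨j≡0 (x - 1ℤ) (trans (factor x) (i≡j⇒i-j≡0 xx≡1))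
    where
    factor : ∀ x → (x - 1ℤ) * (x + 1ℤ) ≡ x * x - 1ℤ
    factor = solve-∀
  ... | inj₁ x-1≡0 = inj₁ (i-j≡0⇒i≡j x 1ℤ x-1≡0)
  ... | inj₂ x+1≡0 = inj₂ (i-j≡0⇒i≡j x -1ℤ x+1≡0)

  module _ {q : ℕ} (q-prime : Prime q) (7≤q : 7 ℕ.≤ q) {χ : ℤ → ℤ} (isχ : IsQuadraticCharacter q χ)
           {K : ℕ} (2≤K : 2 ℕ.≤ K)
           (χ-liouville : ∀ n → 1 ℕ.≤ n → n ℕ.≤ q ℕ.* K → ¬ + q ∣ + n → χ (+ n) ≡ liouville n) where
    open IsQuadraticCharacter isχ
    private
      instance _ = prime⇒nonZero q-prime

      η : ℤ
      η = χ -1ℤ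

      ηη≡1 : η * η ≡ 1ℤ
      ηη≡1 = involutive (∤1 q-prime ∘ ∣m⇒∣-m)

      N : ℤ
      N = η * + q - + 4

      -- The lower bound provides a prime divisor of `N`; the upper bound puts that prime in the
      -- range where `χ` agrees with the Liouville function.
      ∣N∣-bounds : 1 ℕ.< ∣ N ∣ × ∣ N ∣ ℕ.≤ q ℕ.* K
      ∣N∣-bounds = signed-shift-bounds 7≤q 2≤K η (square≡1 ηη≡1)

      -- A common divisor of `N` and 4 divides `η * + q`, hence `q`. This is what excludes the prime
      -- 2 below.
      ∣q : ∀ {d} → + d ∣ N → + d ∣ + 4 → + d ∣ + q
      ∣q {d} d∣N d∣4 = subst (+ d ∣_) ηηq≡q (∣n⇒∣m*n η (subst (+ d ∣_) (identity (η * + q)) (∣m∣n⇒∣m+n d∣N d∣4)))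
        where
        identity : ∀ x → x - + 4 + + 4 ≡ x
        identity = solve-∀
        ηηq≡q : η * (η * + q) ≡ + q
        ηηq≡q = trans (sym (*-assoc η η (+ q))) (trans (cong (_* + q) ηη≡1) (*-identityˡ (+ q)))

      q∤4 : ¬ + q ∣ + 4
      q∤4 q∣4 = ℕₚ.<⇒≱ (ℕₚ.≤-trans (ℕₚ.m≤m+n 5 2) 7≤q) (ℕ∣.∣⇒≤ (∣⇒∣ᵤ q∣4))

      q∤N : ¬ + q ∣ N
      q∤N q∣N = q∤4 (subst (+ q ∣_) (identity (η * + q)) (∣m∣n⇒∣m-n (∣n⇒∣m*n η ∣-refl) q∣N))
        where
        identity : ∀ x → x - (x - + 4) ≡ + 4
        identity = solve-∀

    -- For a prime `p` dividing `N`, `η * + q` is 4 modulo `p`, so reciprocity applies. As `χ (+ p)`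
    -- is -1, it yields that -2 and 2 agree modulo `p`, so `p` divides 4 and then, by `∣q`, equals
    -- `q`, which does not divide `N`.
    liouville-not-quadratic : ⊥
    liouville-not-quadratic with prime-divisor (proj₁ ∣N∣-bounds)
    ... | p , p-prime , p∣N = p∤4 (∣n⇒∣m*n -1ℤ (mod⇒∣ -2≡2))
        where
        instance _ = prime⇒nonZero p-prime

        p∣Nℤ : + p ∣ N
        p∣Nℤ = ∣ᵤ⇒∣ p∣N

        q∤p : ¬ + q ∣ + p
        q∤p q∣p = q∤N (∣-trans q∣p p∣Nℤ)

        divisor-of-q : ∀ {d} → 1 ℕ.< d → + d ∣ + q → d ≡ q
        divisor-of-q 1<d d∣q with prime⇒irreducible q-prime (∣⇒∣ᵤ d∣q)
        ... | inj₁ d≡1 = contradiction (sym d≡1) (ℕₚ.<⇒≢ 1<d)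
        ... | inj₂ d≡q = d≡q

        p∤4 : ¬ + p ∣ + 4
        p∤4 p∣4 = q∤p (subst (λ d → + d ∣ + p)
          (divisor-of-q (ℕ.nonTrivial⇒n>1 p {{prime⇒nonTrivial p-prime}}) (∣q p∣Nℤ p∣4)) ∣-refl)

        2∤p : ¬ 2 ℕ∣.∣ p
        2∤p 2∣p = ℕₚ.<⇒≢ (ℕₚ.≤-trans (ℕₚ.m≤m+n 3 4) 7≤q)
          (divisor-of-q (s≤s (s≤s z≤n)) (∣q (∣-trans (∣ᵤ⇒∣ 2∣p) p∣Nℤ) (divides (+ 2) refl)))

        odd : p ≡ suc ((p ℕ./ 2) ℕ.* 2)
        odd with p ℕ.% 2 in eq | m%n<n p 2 | m≡m%n+[m/n]*n p 2
        ... | zero        | _                 | p≡ = contradiction (ℕ∣.m%n≡0⇒n∣m p 2 eq) 2∤p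
        ... | suc zero    | _                 | p≡ = p≡
        ... | suc (suc _) | s≤s (s≤s ())      | _

        χp≡-1 : χ (+ p) ≡ -1ℤ
        χp≡-1 = trans (χ-liouville p (ℕₚ.<⇒≤ (ℕ.nonTrivial⇒n>1 p {{prime⇒nonTrivial p-prime}}))
                               (ℕₚ.≤-trans (ℕ∣.∣⇒≤ {{ℕ.>-nonZero (ℕₚ.<⇒≤ (proj₁ ∣N∣-bounds))}} p∣N) (proj₂ ∣N∣-bounds)) q∤p)
                      (liouville-prime p-prime)

        -- The prime 2 witnesses that `χ` is not principal.
        χ2≡-1 : χ (+ 2) ≡ -1ℤ
        χ2≡-1 = trans (χ-liouville 2 (s≤s z≤n) (ℕₚ.≤-trans 2≤q (ℕₚ.m≤m*n q K {{ℕ.>-nonZero (ℕₚ.<⇒≤ 2≤K)}})) q∤2)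
                      (liouville-prime prime[2])
          where
          2≤q : 2 ℕ.≤ q
          2≤q = ℕₚ.≤-trans (ℕₚ.m≤m+n 2 5) 7≤q
          q∤2 : ¬ + q ∣ + 2
          q∤2 q∣2 = q∤4 (∣-trans q∣2 (divides (+ 2) refl))

        open Reciprocity q-prime isχ χ2≡-1 p-prime using (reciprocity)

        -2≡2 : - + 2 ≡ + 2 [mod p ]
        -2≡2 = subst (λ y → + 2 * y ≡ + 2 [mod p ]) χp≡-1 (reciprocity (∣⇒mod p∣Nℤ) (p ℕ./ 2) odd q∤p)

  -- Complete multiplicativity of the induced character.

  module Character {q : ℕ} (q-prime : Prime q) {K : ℕ} (K<q : K ℕ.< q) (1≤K : 1 ℕ.≤ K)
                   (q<[1+K]² : q ℕ.< suc K ℕ.* suc K)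
                   (stable : ∀ n → 1 ℕ.≤ n → n ℕ.≤ q ℕ.* K → ¬ + q ∣ + n →
                             liouville n ≡ liouville (_%ℕ_ (+ n) q {{prime⇒nonZero q-prime}})) where
    instance _ = prime⇒nonZero q-prime

    χ : ℤ → ℤ
    χ x = liouville (x %ℕ q)

    χ-periodic : ∀ {x y} → x ≡ y [mod q ] → χ x ≡ χ y
    χ-periodic = cong liouville ∘ %ℕ-cong

    %ℕ≡0 : ∀ {x} → + q ∣ x → x %ℕ q ≡ 0
    %ℕ≡0 {x} q∣x = small-multiple (∣⇒∣ᵤ (∣-resp-mod (mod-sym (mod-%ℕ q x)) q∣x)) (n%ℕd<d x q)

    %ℕ≥1 : ∀ {x} → ¬ + q ∣ x → 1 ℕ.≤ x %ℕ q
    %ℕ≥1 {x} q∤x = ℕₚ.n≢0⇒n>0 λ r≡0 →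
      q∤x (∣-resp-mod (mod-%ℕ q x) (subst (λ r → + q ∣ + r) (sym r≡0) (divides 0ℤ refl)))

    χ-vanishes : ∀ {x} → + q ∣ x → χ x ≡ 0ℤ
    χ-vanishes q∣x = trans (cong liouville (%ℕ≡0 q∣x)) liouville-0

    χ-involutive : ∀ {x} → ¬ + q ∣ x → χ x * χ x ≡ 1ℤ
    χ-involutive = liouville-square ∘ %ℕ≥1

    χ-small : ∀ n → 1 ℕ.≤ n → n ℕ.≤ q ℕ.* K → ¬ + q ∣ + n → χ (+ n) ≡ liouville n
    χ-small n 1≤n n≤qK q∤n = sym (stable n 1≤n n≤qK q∤n)

    small∤ : ∀ {n} → 1 ℕ.≤ n → n ℕ.< q → ¬ + q ∣ + n
    small∤ 1≤n n<q q∣n = ℕₚ.>⇒≢ 1≤n (small-multiple (∣⇒∣ᵤ q∣n) n<q)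

    χ-liouville : ∀ {n} → n ℕ.< q → χ (+ n) ≡ liouville n
    χ-liouville n<q = cong liouville (m<n⇒m%n≡m n<q)

    -- Multiplicativity is proved one left factor at a time: the multipliers contain 1 to `K` and
    -- are closed under products and quotients modulo `q`.
    IsMultiplier : ℤ → Set
    IsMultiplier u = ∀ x → χ (u * x) ≡ χ u * χ x

    -- A factor at most `K` times a residue below `q` stays within `q * K`, where `χ` is the
    -- Liouville function and hence multiplicative.
    multiplier-small : ∀ {s} → 1 ℕ.≤ s → s ℕ.≤ K → IsMultiplier (+ s)
    multiplier-small {s} 1≤s s≤K x with + q ∣? x
    ... | yes q∣x = trans (χ-vanishes (∣n⇒∣m*n (+ s) q∣x))
                          (sym (trans (cong (χ (+ s) *_) (χ-vanishes q∣x)) (*-zeroʳ (χ (+ s)))))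
    ... | no  q∤x = begin
      χ (+ s * x)                 ≡⟨ χ-periodic (mod-*-congˡ (+ s) (mod-sym (mod-%ℕ q x))) ⟩
      χ (+ s * + r)               ≡⟨ cong χ (pos-* s r) ⟨
      χ (+ (s ℕ.* r))             ≡⟨ χ-small (s ℕ.* r) (ℕₚ.*-mono-≤ 1≤s (%ℕ≥1 q∤x)) sr≤qK q∤sr ⟩
      liouville (s ℕ.* r)         ≡⟨ liouville-* s r ⟩
      liouville s * liouville r   ≡⟨ cong (_* liouville r) (χ-liouville (ℕₚ.≤-<-trans s≤K K<q)) ⟨
      χ (+ s) * χ x               ∎
      where
      open ≡-Reasoning
      r = x %ℕ q
      r<q = n%ℕd<d x q
      sr≤qK : s ℕ.* r ℕ.≤ q ℕ.* K
      sr≤qK = subst (ℕ._≤ q ℕ.* K) (ℕₚ.*-comm r s) (ℕₚ.*-mono-≤ (ℕₚ.<⇒≤ r<q) s≤K)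
      q∤sr : ¬ + q ∣ + (s ℕ.* r)
      q∤sr q∣sr with euclid-ℤ q-prime (+ s) (+ r) (subst (+ q ∣_) (pos-* s r) q∣sr)
      ... | inj₁ q∣s = small∤ 1≤s (ℕₚ.≤-<-trans s≤K K<q) q∣s
      ... | inj₂ q∣r = small∤ (%ℕ≥1 q∤x) r<q q∣r

    multiplier-* : ∀ u v → IsMultiplier u → IsMultiplier v → IsMultiplier (u * v)
    multiplier-* u v Mu Mv x = begin
      χ (u * v * x)         ≡⟨ cong χ (*-assoc u v x) ⟩
      χ (u * (v * x))       ≡⟨ Mu (v * x) ⟩
      χ u * χ (v * x)       ≡⟨ cong (χ u *_) (Mv x) ⟩
      χ u * (χ v * χ x)     ≡⟨ *-assoc (χ u) (χ v) (χ x) ⟨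
      χ u * χ v * χ x       ≡⟨ cong (_* χ x) (Mu v) ⟨
      χ (u * v) * χ x       ∎
      where open ≡-Reasoning

    -- Multiplying by `s` turns `u` into `r`; the factor `χ s` then cancels because its square is 1.
    multiplier-quotient : ∀ u s r → ¬ + q ∣ s → IsMultiplier s → IsMultiplier r → u * s ≡ r [mod q ] → IsMultiplier u
    multiplier-quotient u s r q∤s Ms Mr us≡r x = cancelˡ-of-square (χ s) (χ-involutive q∤s) (begin
      χ s * χ (u * x)      ≡⟨ Ms (u * x) ⟨
      χ (s * (u * x))      ≡⟨ cong χ (rearrange s u x) ⟩
      χ (u * s * x)        ≡⟨ χ-periodic (mod-*-congʳ x us≡r) ⟩
      χ (r * x)            ≡⟨ Mr x ⟩
      χ r * χ x            ≡⟨ cong (_* χ x) (χ-periodic us≡r) ⟨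
      χ (u * s) * χ x      ≡⟨ cong (λ y → χ y * χ x) (*-comm u s) ⟩
      χ (s * u) * χ x      ≡⟨ cong (_* χ x) (Ms u) ⟩
      χ s * χ u * χ x      ≡⟨ *-assoc (χ s) (χ u) (χ x) ⟩
      χ s * (χ u * χ x)    ∎)
      where
      open ≡-Reasoning
      rearrange : ∀ s u x → s * (u * x) ≡ u * s * x
      rearrange = solve-∀

    χ-neg-small : ∀ {r} → 1 ℕ.≤ r → r ℕ.≤ K → χ (- + r) ≡ χ -1ℤ * χ (+ r)
    χ-neg-small {r} 1≤r r≤K = begin
      χ (- + r)            ≡⟨ cong χ (identity (+ r)) ⟩
      χ (+ r * -1ℤ)        ≡⟨ multiplier-small 1≤r r≤K -1ℤ ⟩
      χ (+ r) * χ -1ℤ      ≡⟨ *-comm (χ (+ r)) (χ -1ℤ) ⟩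
      χ -1ℤ * χ (+ r)      ∎
      where
      open ≡-Reasoning
      identity : ∀ r → - r ≡ r * -1ℤ
      identity = solve-∀

    q∤-1 : ¬ + q ∣ -1ℤ
    q∤-1 q∣-1 = ∤1 q-prime (∣m⇒∣-m q∣-1)

    -- Thue's lemma is applied to the argument `x`, since for -1 itself it may return only -1 =
    -- -1/1. Multiplying by `s` reduces the claim to `x` equal to plus or minus `r`, where
    -- `χ-neg-small` applies with `r` as the multiplier.
    multiplier-neg : IsMultiplier -1ℤ
    multiplier-neg x with + q ∣? x
    ... | yes q∣x = trans (χ-vanishes (∣n⇒∣m*n -1ℤ q∣x))
                          (sym (trans (cong (χ -1ℤ *_) (χ-vanishes q∣x)) (*-zeroʳ (χ -1ℤ))))
    ... | no  q∤x with thue q-prime K K<q q<[1+K]² x q∤x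
    ... | s , r , (1≤s , s≤K) , (1≤r , r≤K) , xs≡±r = cancelˡ-of-square (χ (+ s)) (χ-involutive (small∤ 1≤s (ℕₚ.≤-<-trans s≤K K<q))) (begin
        χ (+ s) * χ (-1ℤ * x)      ≡⟨ Ms (-1ℤ * x) ⟨
        χ (+ s * (-1ℤ * x))        ≡⟨ cong χ (rearrange (+ s) x) ⟩
        χ (- (x * + s))            ≡⟨ negated xs≡±r ⟩
        χ -1ℤ * χ (x * + s)        ≡⟨ cong (λ y → χ -1ℤ * χ y) (*-comm x (+ s)) ⟩
        χ -1ℤ * χ (+ s * x)        ≡⟨ cong (χ -1ℤ *_) (Ms x) ⟩
        χ -1ℤ * (χ (+ s) * χ x)    ≡⟨ swap (χ -1ℤ) (χ (+ s)) (χ x) ⟩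
        χ (+ s) * (χ -1ℤ * χ x)    ∎)
      where
      open ≡-Reasoning
      Ms = multiplier-small 1≤s s≤K
      rearrange : ∀ s x → s * (-1ℤ * x) ≡ - (x * s)
      rearrange = solve-∀
      swap : ∀ a b c → a * (b * c) ≡ b * (a * c)
      swap = solve-∀
      negated : x * + s ≡ + r [mod q ] ⊎ x * + s ≡ - + r [mod q ] → χ (- (x * + s)) ≡ χ -1ℤ * χ (x * + s)
      negated (inj₁ p) = trans (χ-periodic (mod-neg-cong p))
        (trans (χ-neg-small 1≤r r≤K) (cong (χ -1ℤ *_) (χ-periodic (mod-sym p))))
      -- For the minus sign, two factors `χ -1ℤ` are inserted; their product is 1.
      negated (inj₂ p) = begin
        χ (- (x * + s))            ≡⟨ χ-periodic (mod-neg-cong p) ⟩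
        χ (- - + r)                ≡⟨ cong χ (neg-involutive (+ r)) ⟩
        χ (+ r)                    ≡⟨ *-identityˡ _ ⟨
        1ℤ * χ (+ r)               ≡⟨ cong (_* χ (+ r)) (χ-involutive q∤-1) ⟨
        χ -1ℤ * χ -1ℤ * χ (+ r)    ≡⟨ *-assoc (χ -1ℤ) (χ -1ℤ) (χ (+ r)) ⟩
        χ -1ℤ * (χ -1ℤ * χ (+ r))  ≡⟨ cong (χ -1ℤ *_) (χ-neg-small 1≤r r≤K) ⟨
        χ -1ℤ * χ (- + r)          ≡⟨ cong (χ -1ℤ *_) (χ-periodic p) ⟨
        χ -1ℤ * χ (x * + s)        ∎

    -- By Thue's lemma every unit is plus or minus `r` over `s`, a quotient of known multipliers.
    multiplier : ∀ u → IsMultiplier u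
    multiplier u x with + q ∣? u
    ... | yes q∣u = trans (χ-vanishes (∣m⇒∣m*n x q∣u)) (sym (trans (cong (_* χ x) (χ-vanishes q∣u)) (*-zeroˡ (χ x))))
    ... | no  q∤u with thue q-prime K K<q q<[1+K]² u q∤u
    ... | s , r , (1≤s , s≤K) , (1≤r , r≤K) , inj₁ us≡r =
      multiplier-quotient u (+ s) (+ r) (small∤ 1≤s (ℕₚ.≤-<-trans s≤K K<q))
        (multiplier-small 1≤s s≤K) (multiplier-small 1≤r r≤K) us≡r x
    ... | s , r , (1≤s , s≤K) , (1≤r , r≤K) , inj₂ us≡-r =
      multiplier-quotient u (+ s) (-1ℤ * + r) (small∤ 1≤s (ℕₚ.≤-<-trans s≤K K<q))
        (multiplier-small 1≤s s≤K) (multiplier-* -1ℤ (+ r) multiplier-neg (multiplier-small 1≤r r≤K))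
        (subst (u * + s ≡_[mod q ]) (sym (-1*i≡-i (+ r))) us≡-r) x

    isQuadraticCharacter : IsQuadraticCharacter q χ
    isQuadraticCharacter = record
      { periodic = χ-periodic
      ; multiplicative = multiplier
      ; vanishes = χ-vanishes
      ; involutive = χ-involutive
      }

  -- Both signs occur up to q² times the integer square root of q.

  sqrt : ∀ n → ∃ λ k → k ℕ.* k ℕ.≤ n × n ℕ.< suc k ℕ.* suc k
  sqrt zero = 0 , z≤n , s≤s z≤n
  sqrt (suc n) with sqrt n
  ... | k , k²≤n , n<[1+k]² with suc k ℕ.* suc k ℕ.≤? suc n
  ... | yes [1+k]²≤1+n = suc k , [1+k]²≤1+n ,
        ℕₚ.≤-<-trans n<[1+k]² (ℕₚ.*-mono-< (ℕₚ.n<1+n (suc k)) (ℕₚ.n<1+n (suc k)))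
  ... | no  [1+k]²≰1+n = k , ℕₚ.m≤n⇒m≤1+n k²≤n , ℕₚ.≰⇒> [1+k]²≰1+n

  not-constant : ∀ {q} → Prime q → 7 ℕ.≤ q → ∀ {K} → K ℕ.* K ℕ.≤ q → q ℕ.< suc K ℕ.* suc K →
                 ∀ a → Coprime ∣ a ∣ q → ∀ c →
                 ¬ (∀ n → 1 ℕ.≤ n → n ℕ.≤ q ℕ.* K ℕ.* q → + n ≡ a [mod q ] → liouville n ≡ c)
  not-constant {q} q-prime 7≤q {K} K²≤q q<[1+K]² a a⊥q c constant =
    liouville-not-quadratic q-prime 7≤q isQuadraticCharacter 2≤K χ-small
    where
    instance _ = prime⇒nonZero q-prime

    2≤K : 2 ℕ.≤ K
    2≤K = ℕₚ.≮⇒≥ λ K<2 → ℕₚ.<⇒≱ q<[1+K]²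
      (ℕₚ.≤-trans (ℕₚ.*-mono-≤ K<2 K<2) (ℕₚ.≤-trans (ℕₚ.m≤m+n 4 3) 7≤q))

    K<q : K ℕ.< q
    K<q = ℕₚ.<-≤-trans (ℕₚ.m<m*n K K {{ℕ.>-nonZero (ℕₚ.<⇒≤ 2≤K)}} 2≤K) K²≤q

    q∤a : ¬ + q ∣ a
    q∤a q∣a = ¬prime[1] (subst Prime (a⊥q (∣⇒∣ᵤ q∣a , ℕ∣.∣-refl)) q-prime)

    -- Let `v` below `q` represent `a` divided by `n`. Then `v * n` and `v * r` both lie in the
    -- progression and within its range, so they share the value `c`; the factor `liouville v`
    -- cancels.
    stable : ∀ n → 1 ℕ.≤ n → n ℕ.≤ q ℕ.* K → ¬ + q ∣ + n → liouville n ≡ liouville (+ n %ℕ q)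
    stable n 1≤n n≤qK q∤n = cancelˡ-of-square (liouville v) (liouville-square 1≤v) (begin
      liouville v * liouville n  ≡⟨ liouville-* v n ⟨
      liouville (v ℕ.* n)        ≡⟨ value n 1≤n n≤qK mod-refl ⟩
      c                          ≡⟨ value r 1≤r r≤qK (mod-%ℕ q (+ n)) ⟨
      liouville (v ℕ.* r)        ≡⟨ liouville-* v r ⟩
      liouville v * liouville r  ∎)
      where
      open ≡-Reasoning
      r = + n %ℕ q
      w = proj₁ (inverse q-prime (+ n) q∤n)
      v = (w * a) %ℕ q

      vn≡a : + v * + n ≡ a [mod q ]
      vn≡a = mod-trans (mod-*-congʳ (+ n) (mod-%ℕ q (w * a)))
        (subst₂ (_≡_[mod q ]) (rearrange (+ n) w a) (*-identityˡ a) (mod-*-congʳ a (proj₂ (inverse q-prime (+ n) q∤n))))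
        where
        rearrange : ∀ n w a → n * w * a ≡ w * a * n
        rearrange = solve-∀

      1≤v : 1 ℕ.≤ v
      1≤v = ℕₚ.n≢0⇒n>0 λ v≡0 → q∤a (∣-resp-mod vn≡a (subst (λ z → + q ∣ + z * + n) (sym v≡0) (divides 0ℤ refl)))

      1≤r : 1 ℕ.≤ r
      1≤r = ℕₚ.n≢0⇒n>0 λ r≡0 → q∤n (∣-resp-mod (mod-%ℕ q (+ n)) (subst (λ z → + q ∣ + z) (sym r≡0) (divides 0ℤ refl)))

      r≤qK : r ℕ.≤ q ℕ.* K
      r≤qK = ℕₚ.≤-trans (ℕₚ.<⇒≤ (n%ℕd<d (+ n) q)) (ℕₚ.m≤m*n q K {{ℕ.>-nonZero (ℕₚ.<⇒≤ 2≤K)}})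

      value : ∀ k → 1 ℕ.≤ k → k ℕ.≤ q ℕ.* K → + k ≡ + n [mod q ] → liouville (v ℕ.* k) ≡ c
      value k 1≤k k≤qK k≡n = constant (v ℕ.* k) (ℕₚ.*-mono-≤ 1≤v 1≤k)
        (subst (ℕ._≤ q ℕ.* K ℕ.* q) (ℕₚ.*-comm k v) (ℕₚ.*-mono-≤ k≤qK (ℕₚ.<⇒≤ (n%ℕd<d (w * a) q))))
        (subst (_≡ a [mod q ]) (sym (pos-* v k)) (mod-trans (mod-*-congˡ (+ v) k≡n) vn≡a))

    open Character q-prime K<q (ℕₚ.<⇒≤ 2≤K) q<[1+K]² stable using (isQuadraticCharacter; χ-small)

  -- A finite search decides the existence of `n`. If it fails, every value on the progression in
  -- this range is `- s`, which `not-constant` refutes.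
  attained : ∀ {q} → Prime q → 7 ℕ.≤ q → ∀ a → Coprime ∣ a ∣ q → ∀ {s} → s ≡ 1ℤ ⊎ s ≡ -1ℤ →
             ∃ λ n → 1 ℕ.≤ n × n ℕ.^ 2 ℕ.≤ q ℕ.^ 5 × + q ∣ + n - a × liouville n ≡ s
  attained {q} q-prime 7≤q a a⊥q {s} s≡±1 with sqrt q
  ... | K , K²≤q , q<[1+K]²
    -- The search runs strictly below its bound, hence the successor.
    with ℕₚ.anyUpTo? (λ n → (1 ℕ.≤? n) ×-dec (+ q ∣? (+ n - a)) ×-dec (liouville n ≟ s)) (suc (q ℕ.* K ℕ.* q))
  ... | yes (n , n<1+q²K , 1≤n , q∣n-a , λn≡s) = n , 1≤n , n²≤q⁵ , q∣n-a , λn≡s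
    where
    -- The solver does not normalise literal powers.
    regroup : ∀ q K → q ℕ.* K ℕ.* q ℕ.* (q ℕ.* K ℕ.* q ℕ.* 1) ≡ K ℕ.* K ℕ.* (q ℕ.* (q ℕ.* (q ℕ.* (q ℕ.* 1))))
    regroup = ℕ-Solver.solve-∀
    n²≤q⁵ : n ℕ.^ 2 ℕ.≤ q ℕ.^ 5
    n²≤q⁵ = ℕₚ.≤-trans (ℕₚ.^-monoˡ-≤ 2 (ℕₚ.≤-pred n<1+q²K))
      (ℕₚ.≤-trans (ℕₚ.≤-reflexive (regroup q K)) (ℕₚ.*-monoˡ-≤ (q ℕ.^ 4) K²≤q))
  ... | no ¬attained = contradiction (λ n 1≤n n≤q²K n≡a → opposite s≡±1 (liouville-dichotomy 1≤n)
          (λ λn≡s → ¬attained (n , s≤s n≤q²K , 1≤n , mod⇒∣ n≡a , λn≡s)))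
        (not-constant q-prime 7≤q K²≤q q<[1+K]² a a⊥q (- s))
    where
    opposite : ∀ {s x} → s ≡ 1ℤ ⊎ s ≡ -1ℤ → x ≡ 1ℤ ⊎ x ≡ -1ℤ → x ≢ s → x ≡ - s
    opposite (inj₁ refl) (inj₁ refl) x≢s = contradiction refl x≢s
    opposite (inj₁ refl) (inj₂ refl) x≢s = refl
    opposite (inj₂ refl) (inj₁ refl) x≢s = refl
    opposite (inj₂ refl) (inj₂ refl) x≢s = contradiction refl x≢s

  -- The d-th power of `n² ≤ q⁵`, with the surplus exponent `k` harmless as `q` is positive. For `k`
  -- equal to `2 * e` it is the 2d-th power of the bound with exponent 5/2 + e/d.
  power-bound : ∀ {q n} → 1 ℕ.≤ q → n ℕ.^ 2 ℕ.≤ q ℕ.^ 5 → ∀ d k → n ℕ.^ (2 ℕ.* d) ℕ.≤ q ℕ.^ (5 ℕ.* d ℕ.+ k)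
  power-bound {q} {n} 1≤q n²≤q⁵ d k = begin
    n ℕ.^ (2 ℕ.* d)          ≡⟨ ℕₚ.^-*-assoc n 2 d ⟨
    (n ℕ.^ 2) ℕ.^ d          ≤⟨ ℕₚ.^-monoˡ-≤ d n²≤q⁵ ⟩
    (q ℕ.^ 5) ℕ.^ d          ≡⟨ ℕₚ.^-*-assoc q 5 d ⟩
    q ℕ.^ (5 ℕ.* d)          ≤⟨ ℕₚ.^-monoʳ-≤ q {{ℕ.>-nonZero 1≤q}} (ℕₚ.m≤m+n (5 ℕ.* d) k) ⟩
    q ℕ.^ (5 ℕ.* d ℕ.+ k)    ∎
    where open ℕₚ.≤-Reasoning

open import Defs
open import Data.Nat using (ℕ; _≤_; _*_; _+_; _^_; NonZero)
open import Data.Nat.Primality using (Prime)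
open import Data.Nat.Coprimality using (Coprime)
open import Data.Integer using (ℤ; +_; -_; ∣_∣)
open import Data.Integer using () renaming (_-_ to _-ℤ_)
open import Data.Integer.Divisibility using () renaming (_∣_ to _∣ℤ_)
open import Data.Product using (Σ; _×_)

theorem1 : (e d : ℕ) → 1 ≤ e → 1 ≤ d →
    Σ ℕ (λ Q → (q : ℕ) → Prime q → Q ≤ q → (a : ℤ) → Coprime ∣ a ∣ q →
    Σ ℕ (λ n → Σ ℕ (λ m →
    (1 ≤ n × n ^ (2 * d) ≤ q ^ (5 * d + 2 * e) × (+ q) ∣ℤ ((+ n) -ℤ a) × Liouville≡ n (- (+ 1)))
    × (1 ≤ m × m ^ (2 * d) ≤ q ^ (5 * d + 2 * e) × (+ q) ∣ℤ ((+ m) -ℤ a) × Liouville≡ m (+ 1)))))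
-- The threshold is the first prime at which q - 4 exceeds 1, as the choice of a prime divisor of
-- `N` requires when `η` is 1.
theorem1 e d _ _ = 7 , λ q q-prime 7≤q a a⊥q →
  let n , 1≤n , n²≤q⁵ , q∣n-a , λn≡-1 = attained q-prime 7≤q a a⊥q (inj₂ refl)
      m , 1≤m , m²≤q⁵ , q∣m-a , λm≡1  = attained q-prime 7≤q a a⊥q (inj₁ refl)
      1≤q = ≤-trans (s≤s z≤n) 7≤q
  in n , m ,
     (1≤n , power-bound 1≤q n²≤q⁵ d (2 * e) , ∣⇒∣ᵤ q∣n-a , subst (Liouville≡ n) λn≡-1 (Liouville≡-liouville 1≤n)) ,
     (1≤m , power-bound 1≤q m²≤q⁵ d (2 * e) , ∣⇒∣ᵤ q∣m-a , subst (Liouville≡ m) λm≡1 (Liouville≡-liouville 1≤m))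
  where
  open Proof using (attained; power-bound; Liouville≡-liouville)
  open import Data.Integer.Divisibility.Signed using (∣⇒∣ᵤ)
  open import Data.Nat using (z≤n; s≤s)
  open import Data.Nat.Properties using (≤-trans)
  open import Data.Product using (_,_)
  open import Data.Sum using (inj₁; inj₂)
  open import Relation.Binary.PropositionalEquality using (refl; subst)
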